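{- Let $r\geq 2$ and $n\geq 1$ be integers, and let $K_n^r$ be the $r$-complete hypergraph of order $n$. Let $a_1(K_n^r)$ be the coefficient of $\lambda$ in the chromatic polynomial of $K_n^r$. Then $$a_1(K_n^r)=-(n-1)!\,\mu_{r-1}(n),$$ where, for an integer $m\geq 1$, $$\mu_m(n)=\sum_{i=1}^{m}R_i^{ -n}$$ and $R_1,\dots,R_m$ denote the (complex) roots of the $m$-th Taylor polynomial $E_m(x)=\sum_{k=0}^{m}\frac{x^k}{k!}$ of the exponential function.
   Context: The $r$-complete hypergraph $K_n^r$ of order $n$ has vertex set $V=\{1,2,\dots,n\}$ and its edge set consists of all subsets of $V$ of cardinality $r$ (so there are no edges if $n<r$). For a hypergraph $H=(V,E)$ (with $V$ finite non-empty and $E$ a set of subsets of $V$ of cardinality at least $2$) and $\lambda\in\mathbb{N}$, a proper $\lambda$-colouring is a map $\pi:V\to\{1,\dots,\lambda\}$ such that each edge contains two vertices $x,y$ with $\pi(x)\neq\pi(y)$. The number $\chi_H(\lambda)$ of proper $\lambda$-colourings is a polynomial in $\lambda$, the chromatic polynomial of $H$, given by $\chi_H(\lambda)=\sum_{F\subseteq E}(-1)^{|F|}\lambda^{k(F)}$, where $k(F)$ is the number of connected components of $(V,F)$ (isolated vertices count as components). Thus $a_1(H)=\sum_{F\subseteq E,\,k(F)=1}(-1)^{|F|}$. -}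

module Defs where

open import Algebra.Bundles using (CommutativeRing)
import Algebra.Definitions
import Algebra.Properties.CommutativeMonoid.Sum as Sum
import Algebra.Properties.Ring
import Algebra.Properties.Semiring.Exp as Exp
open import Data.Bool.Base using (if_then_else_)
open import Data.Fin.Base as Fin using (Fin; zero; suc; toℕ; _↑ˡ_; _↑ʳ_; combine; finToFun)
import Data.Fin.Permutation as Perm
import Data.Fin.Properties as Fin
open import Data.Fin.Subset using (Subset; _∈_) renaming (∣_∣ to size)
open import Data.Fin.Subset.Properties using (anySubset?; _∈?_)
open import Data.Integer.Base as ℤ using (ℤ; +_; 0ℤ; 1ℤ)
import Data.Integer.Properties as ℤ
import Data.Integer.Solver as ℤ-Solver
open import Data.List.Base using (List; []; _∷_; map; length; filter; tabulate; allFin)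
open import Data.Nat.Base as ℕ using (ℕ; zero; suc; _⊔_; _!)
import Data.Nat.Properties as ℕ
open import Data.Product.Base using (_×_; _,_; proj₁; proj₂; ∃-syntax)
open import Data.Rational.Base as ℚ using (ℚ; 0ℚ; 1ℚ; ½; ∣_∣; 1/_; _<_; _≤_)
import Data.Rational.Properties as ℚ
open import Data.Rational.Solver using (module +-*-Solver)
open import Data.Vec.Base as Vec using (Vec; []; _∷_; lookup)
import Data.Vec.Properties as Vec
open import Function.Base using (_∘_)
open import Level using (0ℓ)
import Relation.Binary.Reasoning.Setoid as SetoidReasoning
open import Relation.Binary.Definitions using (DecidableEquality)
open import Relation.Binary.PropositionalEquality
  using (_≡_; _≢_; refl; sym; trans; cong; cong₂; subst; module ≡-Reasoning)
open import Relation.Nullary.Decidable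
  using (Dec; yes; no; does; ¬?; _×-dec_; map′; decidable-stable; dec-true; dec-false)
open import Relation.Nullary.Negation using (¬_; contradiction)
open import Relation.Unary using (Pred; Decidable)

module CauchyReals where

  private
    variable
      d e b : ℕ → ℕ → ℚ

    Null₂ : (ℕ → ℕ → ℚ) → Set
    Null₂ d = ∀ ε → 0ℚ < ε → ∃[ N ] (∀ i j → N ℕ.≤ i → N ℕ.≤ j → ∣ d i j ∣ < ε)

    EventuallyBounded : (ℕ → ℕ → ℚ) → Set
    EventuallyBounded b =
      ∃[ B ] 0ℚ < B × ∃[ N ] (∀ i j → N ℕ.≤ i → N ℕ.≤ j → ∣ b i j ∣ ≤ B)

  IsCauchy : (ℕ → ℚ) → Set
  IsCauchy x = ∀ ε → 0ℚ < ε →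
    ∃[ N ] (∀ i j → N ℕ.≤ i → N ℕ.≤ j → ∣ x i ℚ.- x j ∣ < ε)

  -- A real number is a Cauchy sequence of rationals, and _≈_ below identifies
  -- sequences whose difference tends to 0. Operations are given by copatterns
  -- without eta so that terms such as x + y do not unfold during unification.
  record ℝ : Set where
    no-eta-equality
    field
      seq    : ℕ → ℚ
      cauchy : IsCauchy seq
  open ℝ public

  infix 4 _≈_
  record _≈_ (x y : ℝ) : Set where
    constructor mk≈
    field
      close : ∀ ε → 0ℚ < ε → ∃[ N ] (∀ i → N ℕ.≤ i → ∣ seq x i ℚ.- seq y i ∣ < ε)

  private
    open +-*-Solver using (solve; _:=_; _:+_; _:*_; _:-_; :-_)

    sum-difference : ∀ a b c d → (a ℚ.- b) ℚ.+ (c ℚ.- d) ≡ (a ℚ.+ c) ℚ.- (b ℚ.+ d)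
    sum-difference = solve 4 (λ a b c d → (a :- b) :+ (c :- d) := (a :+ c) :- (b :+ d)) refl

    product-difference : ∀ a b c d →
      b ℚ.* (a ℚ.- c) ℚ.+ c ℚ.* (b ℚ.- d) ≡ a ℚ.* b ℚ.- c ℚ.* d
    product-difference = solve 4
      (λ a b c d → b :* (a :- c) :+ c :* (b :- d) := a :* b :- c :* d) refl

    abstract
      0<* : ∀ {p q} → 0ℚ < p → 0ℚ < q → 0ℚ < p ℚ.* q
      0<* {p} {q} 0<p 0<q =
        ℚ.positive⁻¹ _ {{ℚ.pos*pos⇒pos p {{ℚ.positive 0<p}} q {{ℚ.positive 0<q}}}}

      0<½* : ∀ {ε} → 0ℚ < ε → 0ℚ < ½ ℚ.* ε
      0<½* = 0<* (ℚ.positive⁻¹ ½)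

      halves : ∀ ε → ½ ℚ.* ε ℚ.+ ½ ℚ.* ε ≡ ε
      halves ε = trans (sym (ℚ.*-distribʳ-+ ε ½ ½)) (ℚ.*-identityˡ ε)

      ⊔≤ˡ : ∀ M N {i} → M ⊔ N ℕ.≤ i → M ℕ.≤ i
      ⊔≤ˡ M N = ℕ.≤-trans (ℕ.m≤m⊔n M N)

      ⊔≤ʳ : ∀ M N {i} → M ⊔ N ℕ.≤ i → N ℕ.≤ i
      ⊔≤ʳ M N = ℕ.≤-trans (ℕ.m≤n⊔m M N)

      null-resp : (∀ i j → d i j ≡ e i j) → Null₂ d → Null₂ e
      null-resp d≡e h ε 0<ε with h ε 0<ε
      ... | N , p = N , λ i j N≤i N≤j → subst (λ q → ∣ q ∣ < ε) (d≡e i j) (p i j N≤i N≤j)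

      null-zero : (∀ i j → d i j ≡ 0ℚ) → Null₂ d
      null-zero d≡0 ε 0<ε = 0 , λ i j _ _ → subst (λ q → ∣ q ∣ < ε) (sym (d≡0 i j)) 0<ε

      null-neg : Null₂ d → Null₂ (λ i j → ℚ.- d i j)
      null-neg {d} h ε 0<ε with h ε 0<ε
      ... | N , p = N , λ i j N≤i N≤j → subst (_< ε) (sym (ℚ.∣-p∣≡∣p∣ (d i j))) (p i j N≤i N≤j)

      null-+ : Null₂ d → Null₂ e → Null₂ (λ i j → d i j ℚ.+ e i j)
      null-+ {d} {e} h k ε 0<ε with h (½ ℚ.* ε) (0<½* 0<ε) | k (½ ℚ.* ε) (0<½* 0<ε)
      ... | M , p | N , q = M ⊔ N , λ i j ≤i ≤j →
        ℚ.≤-<-trans (ℚ.∣p+q∣≤∣p∣+∣q∣ (d i j) (e i j))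
          (subst (_ <_) (halves ε)
            (ℚ.+-mono-< (p i j (⊔≤ˡ M N ≤i) (⊔≤ˡ M N ≤j)) (q i j (⊔≤ʳ M N ≤i) (⊔≤ʳ M N ≤j))))

      reciprocal : ∀ {B} → 0ℚ < B → ∃[ C ] 0ℚ < C × (∀ ε → B ℚ.* (C ℚ.* ε) ≡ ε)
      reciprocal {B} 0<B = 1/ B , ℚ.positive⁻¹ (1/ B) {{ℚ.1/pos⇒pos B}} , λ ε →
        trans (sym (ℚ.*-assoc B (1/ B) ε))
          (trans (cong (ℚ._* ε) (ℚ.*-inverseʳ B)) (ℚ.*-identityˡ ε))
        where
        instance
          B-pos : ℚ.Positive B
          B-pos = ℚ.positive 0<B
          B≢0 : ℚ.NonZero B
          B≢0 = ℚ.pos⇒nonZero B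

      null-* : EventuallyBounded b → Null₂ d → Null₂ (λ i j → b i j ℚ.* d i j)
      null-* {b} {d} (B , 0<B , M , bound) h ε 0<ε with reciprocal 0<B
      ... | C , 0<C , B*Cε≡ε with h (C ℚ.* ε) (0<* 0<C 0<ε)
      ... | N , p = M ⊔ N , λ i j ≤i ≤j →
        subst (_< ε) (sym (ℚ.∣p*q∣≡∣p∣*∣q∣ (b i j) (d i j)))
          (ℚ.≤-<-trans
            (ℚ.*-monoʳ-≤-nonNeg ∣ d i j ∣ {{ℚ.nonNegative (ℚ.0≤∣p∣ (d i j))}}
              (bound i j (⊔≤ˡ M N ≤i) (⊔≤ˡ M N ≤j)))
            (subst (B ℚ.* ∣ d i j ∣ <_) (B*Cε≡ε ε)
              (ℚ.*-monoʳ-<-pos B {{ℚ.positive 0<B}} (p i j (⊔≤ʳ M N ≤i) (⊔≤ʳ M N ≤j)))))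

      bounded : ∀ x → ∃[ B ] 0ℚ < B × ∃[ N ] (∀ i → N ℕ.≤ i → ∣ seq x i ∣ ≤ B)
      bounded x with cauchy x 1ℚ (ℚ.positive⁻¹ 1ℚ)
      ... | N , p = 1ℚ ℚ.+ ∣ seq x N ∣
                  , ℚ.+-mono-<-≤ (ℚ.positive⁻¹ 1ℚ) (ℚ.0≤∣p∣ (seq x N))
                  , N
                  , λ i N≤i → subst (λ q → ∣ q ∣ ≤ 1ℚ ℚ.+ ∣ seq x N ∣) (cancel (seq x i) (seq x N))
                      (ℚ.≤-trans (ℚ.∣p+q∣≤∣p∣+∣q∣ (seq x i ℚ.- seq x N) (seq x N))
                        (ℚ.+-monoˡ-≤ ∣ seq x N ∣ (ℚ.<⇒≤ (p i N N≤i ℕ.≤-refl))))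
        where
        cancel : ∀ p q → (p ℚ.- q) ℚ.+ q ≡ p
        cancel = solve 2 (λ p q → (p :- q) :+ q := p) refl

      boundedˡ : ∀ x → EventuallyBounded (λ i _ → seq x i)
      boundedˡ x = let B , 0<B , N , p = bounded x in B , 0<B , N , λ i _ N≤i _ → p i N≤i

      boundedʳ : ∀ x → EventuallyBounded (λ _ j → seq x j)
      boundedʳ x = let B , 0<B , N , p = bounded x in B , 0<B , N , λ _ j _ N≤j → p j N≤j

      mk≈₂ : ∀ {x y} → Null₂ (λ i _ → seq x i ℚ.- seq y i) → x ≈ y
      mk≈₂ h = mk≈ λ ε 0<ε → let N , p = h ε 0<ε in N , λ i N≤i → p i i N≤i N≤i

      close₂ : ∀ {x y} → x ≈ y → Null₂ (λ i _ → seq x i ℚ.- seq y i)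
      close₂ (mk≈ h) ε 0<ε = let N , p = h ε 0<ε in N , λ i _ N≤i _ → p i N≤i

  abstract
    pointwise : ∀ {x y} → (∀ i → seq x i ≡ seq y i) → x ≈ y
    pointwise {x} {y} x≡y = mk≈₂ (null-zero λ i _ →
      trans (cong (ℚ._- seq y i) (x≡y i)) (ℚ.+-inverseʳ (seq y i)))

  infixl 6 _+_
  infixl 7 _*_
  infix  8 -_

  fromℚ : ℚ → ℝ
  seq    (fromℚ q) _ = q
  cauchy (fromℚ q)   = null-zero λ _ _ → ℚ.+-inverseʳ q

  _+_ : ℝ → ℝ → ℝ
  seq    (x + y) i = seq x i ℚ.+ seq y i
  cauchy (x + y)   =
    null-resp (λ i j → sum-difference (seq x i) (seq x j) (seq y i) (seq y j))
      (null-+ (cauchy x) (cauchy y))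

  -_ : ℝ → ℝ
  seq    (- x) i = ℚ.- seq x i
  cauchy (- x)   =
    null-resp (λ i j → ℚ.neg-distrib-+ (seq x i) (ℚ.- seq x j)) (null-neg (cauchy x))

  _*_ : ℝ → ℝ → ℝ
  seq    (x * y) i = seq x i ℚ.* seq y i
  cauchy (x * y)   =
    null-resp (λ i j → product-difference (seq x i) (seq y i) (seq x j) (seq y j))
      (null-+ (null-* (boundedˡ y) (cauchy x)) (null-* (boundedʳ x) (cauchy y)))

  private
    ≈-refl : ∀ {x} → x ≈ x
    ≈-refl = pointwise λ _ → refl

    ≈-sym : ∀ {x y} → x ≈ y → y ≈ x
    ≈-sym {x} {y} x≈y = mk≈₂ (null-resp (λ i _ → flip- (seq x i) (seq y i)) (null-neg (close₂ x≈y)))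
      where
      flip- : ∀ p q → ℚ.- (p ℚ.- q) ≡ q ℚ.- p
      flip- = solve 2 (λ p q → :- (p :- q) := q :- p) refl

    ≈-trans : ∀ {x y z} → x ≈ y → y ≈ z → x ≈ z
    ≈-trans {x} {y} {z} x≈y y≈z = mk≈₂ (null-resp
      (λ i _ → telescope (seq x i) (seq y i) (seq z i)) (null-+ (close₂ x≈y) (close₂ y≈z)))
      where
      telescope : ∀ p q r → (p ℚ.- q) ℚ.+ (q ℚ.- r) ≡ p ℚ.- r
      telescope = solve 3 (λ p q r → (p :- q) :+ (q :- r) := p :- r) refl

    +-cong : ∀ {x y u v} → x ≈ y → u ≈ v → x + u ≈ y + v
    +-cong {x} {y} {u} {v} x≈y u≈v = mk≈₂ (null-resp
      (λ i _ → sum-difference (seq x i) (seq y i) (seq u i) (seq v i))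
      (null-+ (close₂ x≈y) (close₂ u≈v)))

    -‿cong : ∀ {x y} → x ≈ y → - x ≈ - y
    -‿cong {x} {y} x≈y = mk≈₂ (null-resp
      (λ i _ → ℚ.neg-distrib-+ (seq x i) (ℚ.- seq y i)) (null-neg (close₂ x≈y)))

    *-cong : ∀ {x y u v} → x ≈ y → u ≈ v → x * u ≈ y * v
    *-cong {x} {y} {u} {v} x≈y u≈v = mk≈₂ (null-resp
      (λ i _ → product-difference (seq x i) (seq u i) (seq y i) (seq v i))
      (null-+ (null-* (boundedˡ u) (close₂ x≈y)) (null-* (boundedˡ y) (close₂ u≈v))))

  ℝ-commutativeRing : CommutativeRing 0ℓ 0ℓ
  ℝ-commutativeRing = record
    { Carrier = ℝ
    ; _≈_ = _≈_
    ; _+_ = _+_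
    ; _*_ = _*_
    ; -_ = -_
    ; 0# = fromℚ 0ℚ
    ; 1# = fromℚ 1ℚ
    ; isCommutativeRing = record
      { isRing = record
        { +-isAbelianGroup = record
          { isGroup = record
            { isMonoid = record
              { isSemigroup = record
                { isMagma = record
                  { isEquivalence = record { refl = ≈-refl ; sym = ≈-sym ; trans = ≈-trans }
                  ; ∙-cong = +-cong
                  }
                ; assoc = λ x y z → pointwise λ i → ℚ.+-assoc (seq x i) (seq y i) (seq z i)
                }
              ; identity = (λ x → pointwise λ i → ℚ.+-identityˡ (seq x i))
                         , (λ x → pointwise λ i → ℚ.+-identityʳ (seq x i))
              }
            ; inverse = (λ x → pointwise λ i → ℚ.+-inverseˡ (seq x i))
                      , (λ x → pointwise λ i → ℚ.+-inverseʳ (seq x i))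
            ; ⁻¹-cong = -‿cong
            }
          ; comm = λ x y → pointwise λ i → ℚ.+-comm (seq x i) (seq y i)
          }
        ; *-cong = *-cong
        ; *-assoc = λ x y z → pointwise λ i → ℚ.*-assoc (seq x i) (seq y i) (seq z i)
        ; *-identity = (λ x → pointwise λ i → ℚ.*-identityˡ (seq x i))
                     , (λ x → pointwise λ i → ℚ.*-identityʳ (seq x i))
        ; distrib = (λ x y z → pointwise λ i → ℚ.*-distribˡ-+ (seq x i) (seq y i) (seq z i))
                  , (λ x y z → pointwise λ i → ℚ.*-distribʳ-+ (seq x i) (seq y i) (seq z i))
        }
      ; *-comm = λ x y → pointwise λ i → ℚ.*-comm (seq x i) (seq y i)
      }
    }

module ComplexNumbers where

  open CauchyReals using (ℝ; seq; pointwise; ℝ-commutativeRing)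
  private module R = CommutativeRing ℝ-commutativeRing
  open R using () renaming (_≈_ to _≈ᵣ_; _+_ to _+ᵣ_; _*_ to _*ᵣ_; -_ to -ᵣ_; 0# to 0ᵣ)

  record ℂ : Set where
    no-eta-equality
    field
      re im : ℝ
  open ℂ public

  infix 4 _≈_
  record _≈_ (z w : ℂ) : Set where
    constructor mk≈
    field
      re≈ : re z ≈ᵣ re w
      im≈ : im z ≈ᵣ im w

  infixl 6 _+_
  infixl 7 _*_
  infix  8 -_

  _+_ : ℂ → ℂ → ℂ
  re (z + w) = re z +ᵣ re w
  im (z + w) = im z +ᵣ im w

  _*_ : ℂ → ℂ → ℂ
  re (z * w) = (re z *ᵣ re w) +ᵣ (-ᵣ (im z *ᵣ im w))
  im (z * w) = (re z *ᵣ im w) +ᵣ (im z *ᵣ re w)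

  -_ : ℂ → ℂ
  re (- z) = -ᵣ re z
  im (- z) = -ᵣ im z

  fromℚ : ℚ → ℂ
  re (fromℚ q) = CauchyReals.fromℚ q
  im (fromℚ q) = 0ᵣ

  ℂ-commutativeRing : CommutativeRing 0ℓ 0ℓ
  ℂ-commutativeRing = record
    { Carrier = ℂ
    ; _≈_ = _≈_
    ; _+_ = _+_
    ; _*_ = _*_
    ; -_ = -_
    ; 0# = fromℚ 0ℚ
    ; 1# = fromℚ 1ℚ
    ; isCommutativeRing = record
      { isRing = record
        { +-isAbelianGroup = record
          { isGroup = record
            { isMonoid = record
              { isSemigroup = record
                { isMagma = record
                  { isEquivalence = record
                    { refl = mk≈ R.refl R.refl
                    ; sym = λ (mk≈ p q) → mk≈ (R.sym p) (R.sym q)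
                    ; trans = λ (mk≈ p q) (mk≈ r s) → mk≈ (R.trans p r) (R.trans q s)
                    }
                  ; ∙-cong = λ (mk≈ p q) (mk≈ r s) → mk≈ (R.+-cong p r) (R.+-cong q s)
                  }
                ; assoc = λ _ _ _ → mk≈ (R.+-assoc _ _ _) (R.+-assoc _ _ _)
                }
              ; identity = (λ _ → mk≈ (R.+-identityˡ _) (R.+-identityˡ _))
                         , (λ _ → mk≈ (R.+-identityʳ _) (R.+-identityʳ _))
              }
            ; inverse = (λ _ → mk≈ (R.-‿inverseˡ _) (R.-‿inverseˡ _))
                      , (λ _ → mk≈ (R.-‿inverseʳ _) (R.-‿inverseʳ _))
            ; ⁻¹-cong = λ (mk≈ p q) → mk≈ (R.-‿cong p) (R.-‿cong q)
            }
          ; comm = λ _ _ → mk≈ (R.+-comm _ _) (R.+-comm _ _)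
          }
        ; *-cong = λ (mk≈ p q) (mk≈ r s) → mk≈
            (R.+-cong (R.*-cong p r) (R.-‿cong (R.*-cong q s)))
            (R.+-cong (R.*-cong p s) (R.*-cong q r))
        ; *-assoc = *-assoc
        ; *-identity = *-identityˡ
                     , λ x → ≈-trans (*-comm x (fromℚ 1ℚ)) (*-identityˡ x)
        ; distrib = *-distribˡ
                  , λ x y z → ≈-trans (*-comm (y + z) x)
                      (≈-trans (*-distribˡ x y z) (+-cong (*-comm x y) (*-comm x z)))
        }
      ; *-comm = *-comm
      }
    }
    where
    ≈-trans : ∀ {x y z} → x ≈ y → y ≈ z → x ≈ z
    ≈-trans (mk≈ p q) (mk≈ r s) = mk≈ (R.trans p r) (R.trans q s)

    +-cong : ∀ {x y u v} → x ≈ y → u ≈ v → x + u ≈ y + v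
    +-cong (mk≈ p q) (mk≈ r s) = mk≈ (R.+-cong p r) (R.+-cong q s)

    *-comm : ∀ x y → x * y ≈ y * x
    *-comm x y = mk≈
      (R.+-cong (R.*-comm (re x) (re y)) (R.-‿cong (R.*-comm (im x) (im y))))
      (R.trans (R.+-comm (re x *ᵣ im y) (im x *ᵣ re y))
        (R.+-cong (R.*-comm (im x) (re y)) (R.*-comm (re x) (im y))))

    open +-*-Solver using (solve; con; _:=_; _:+_; _:*_; _:-_)

    *-identityˡ : ∀ x → fromℚ 1ℚ * x ≈ x
    *-identityˡ x = mk≈
      (pointwise λ i → solve 2 (λ a b → con 1ℚ :* a :- con 0ℚ :* b := a) refl (seq (re x) i) (seq (im x) i))
      (pointwise λ i → solve 2 (λ a b → con 1ℚ :* b :+ con 0ℚ :* a := b) refl (seq (re x) i) (seq (im x) i))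

    *-assoc : ∀ x y z → (x * y) * z ≈ x * (y * z)
    *-assoc x y z = mk≈
      (pointwise λ i → solve 6 (λ a b c d e f →
        (a :* c :- b :* d) :* e :- (a :* d :+ b :* c) :* f
          := a :* (c :* e :- d :* f) :- b :* (c :* f :+ d :* e))
        refl (seq (re x) i) (seq (im x) i) (seq (re y) i) (seq (im y) i)
             (seq (re z) i) (seq (im z) i))
      (pointwise λ i → solve 6 (λ a b c d e f →
        (a :* c :- b :* d) :* f :+ (a :* d :+ b :* c) :* e
          := a :* (c :* f :+ d :* e) :+ b :* (c :* e :- d :* f))
        refl (seq (re x) i) (seq (im x) i) (seq (re y) i) (seq (im y) i)
             (seq (re z) i) (seq (im z) i))

    *-distribˡ : ∀ x y z → x * (y + z) ≈ x * y + x * z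
    *-distribˡ x y z = mk≈
      (pointwise λ i → solve 6 (λ a b c d e f →
        a :* (c :+ e) :- b :* (d :+ f) := (a :* c :- b :* d) :+ (a :* e :- b :* f))
        refl (seq (re x) i) (seq (im x) i) (seq (re y) i) (seq (im y) i)
             (seq (re z) i) (seq (im z) i))
      (pointwise λ i → solve 6 (λ a b c d e f →
        a :* (d :+ f) :+ b :* (c :+ e) := (a :* d :+ b :* c) :+ (a :* f :+ b :* e))
        refl (seq (re x) i) (seq (im x) i) (seq (re y) i) (seq (im y) i)
             (seq (re z) i) (seq (im z) i))

module Polynomials where

  -- The coefficient of Xⁱ is the i-th entry; trailing zeros are allowed.
  Polynomial : Set
  Polynomial = List ℤ

  coefficient : Polynomial → ℕ → ℤ
  coefficient []      _       = 0ℤ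
  coefficient (a ∷ p) zero    = a
  coefficient (a ∷ p) (suc i) = coefficient p i

  eval : Polynomial → ℤ → ℤ
  eval []      x = 0ℤ
  eval (a ∷ p) x = a ℤ.+ x ℤ.* eval p x

open Polynomials

module Hypergraphs where

  record Hypergraph : Set₁ where
    field
      order    : ℕ
      nonempty : 1 ℕ.≤ order
      Edge     : Pred (Subset order) 0ℓ
      edge?    : Decidable Edge
      2≤∣edge∣ : ∀ {e} → Edge e → 2 ℕ.≤ size e

  open Hypergraph public

  K : (r n : ℕ) → 2 ℕ.≤ r → 1 ℕ.≤ n → Hypergraph
  K r n 2≤r 1≤n = record
    { order    = n
    ; nonempty = 1≤n
    ; Edge     = λ e → size e ≡ r
    ; edge?    = λ e → size e ℕ.≟ r
    ; 2≤∣edge∣ = λ { refl → 2≤r }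
    }

  module _ (H : Hypergraph) {A : Set} where

    Proper : (Fin (order H) → A) → Set
    Proper π = ∀ e → Edge H e → ∃[ x ] ∃[ y ] x ∈ e × y ∈ e × π x ≢ π y

    proper? : DecidableEquality A → Decidable Proper
    proper? _≟_ π = map′ allGood noneBad (¬? (anySubset? (λ e → edge? H e ×-dec ¬? (good? e))))
      where
      Good : Subset (order H) → Set
      Good e = ∃[ x ] ∃[ y ] x ∈ e × y ∈ e × π x ≢ π y
      good? : Decidable Good
      good? e = Fin.any? λ x → Fin.any? λ y → (x ∈? e) ×-dec (y ∈? e) ×-dec ¬? (π x ≟ π y)
      allGood : ¬ (∃[ e ] Edge H e × ¬ Good e) → Proper π
      allGood none e e∈E = decidable-stable (good? e) λ bad → none (e , e∈E , bad)
      noneBad : Proper π → ¬ (∃[ e ] Edge H e × ¬ Good e)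
      noneBad proper (e , e∈E , bad) = bad (proper e e∈E)

  -- finToFun enumerates the maps Fin n → Fin l bijectively by Fin (l ^ n).
  #properColourings : Hypergraph → ℕ → ℕ
  #properColourings H l =
    length (filter (λ i → proper? H Fin._≟_ (finToFun i)) (allFin (l ℕ.^ order H)))

  IsChromaticPolynomial : Hypergraph → Polynomial → Set
  IsChromaticPolynomial H p = ∀ l → eval p (+ l) ≡ + #properColourings H l

open Hypergraphs

-- The number of proper l-colourings of a hypergraph is a polynomial in l: the
-- chromatic polynomial is built below together with a proof of this property,
-- which determines it up to trailing zero coefficients.
module ChromaticPolynomial where

  open ≡-Reasoning
  open Sum ℤ.+-0-commutativeMonoid using (sum; sum-permute; sum-cong-≗)
  open ℤ-Solver.+-*-Solver using (solve; con; _:=_; _:+_; _:*_; _:-_)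

  private

    _⊕_ : Polynomial → Polynomial → Polynomial
    []      ⊕ q       = q
    (a ∷ p) ⊕ []      = a ∷ p
    (a ∷ p) ⊕ (b ∷ q) = (a ℤ.+ b) ∷ (p ⊕ q)

    scale : ℤ → Polynomial → Polynomial
    scale c = map (c ℤ.*_)

    -- (X − c) · p
    timesX- : ℤ → Polynomial → Polynomial
    timesX- c p = (0ℤ ∷ p) ⊕ scale (ℤ.- c) p

    ⨁ : ∀ k → (Fin k → Polynomial) → Polynomial
    ⨁ zero    f = []
    ⨁ (suc k) f = f zero ⊕ ⨁ k (f ∘ suc)

    eval-⊕ : ∀ p q x → eval (p ⊕ q) x ≡ eval p x ℤ.+ eval q x
    eval-⊕ []      q       x = sym (ℤ.+-identityˡ _)
    eval-⊕ (a ∷ p) []      x = sym (ℤ.+-identityʳ _)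
    eval-⊕ (a ∷ p) (b ∷ q) x = trans
      (cong (λ y → a ℤ.+ b ℤ.+ x ℤ.* y) (eval-⊕ p q x))
      (solve 5 (λ a b x p q → a :+ b :+ x :* (p :+ q) := (a :+ x :* p) :+ (b :+ x :* q))
        refl a b x (eval p x) (eval q x))

    eval-scale : ∀ c p x → eval (scale c p) x ≡ c ℤ.* eval p x
    eval-scale c []      x = sym (ℤ.*-zeroʳ c)
    eval-scale c (a ∷ p) x = trans
      (cong (λ y → c ℤ.* a ℤ.+ x ℤ.* y) (eval-scale c p x))
      (solve 4 (λ a x p c → c :* a :+ x :* (c :* p) := c :* (a :+ x :* p)) refl a x (eval p x) c)

    eval-timesX- : ∀ c p x → eval (timesX- c p) x ≡ (x ℤ.- c) ℤ.* eval p x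
    eval-timesX- c p x = begin
      eval ((0ℤ ∷ p) ⊕ scale (ℤ.- c) p) x                  ≡⟨ eval-⊕ (0ℤ ∷ p) (scale (ℤ.- c) p) x ⟩
      (0ℤ ℤ.+ x ℤ.* eval p x) ℤ.+ eval (scale (ℤ.- c) p) x ≡⟨ cong₂ ℤ._+_ (ℤ.+-identityˡ (x ℤ.* eval p x)) (eval-scale (ℤ.- c) p x) ⟩
      x ℤ.* eval p x ℤ.+ (ℤ.- c) ℤ.* eval p x              ≡⟨ ℤ.*-distribʳ-+ (eval p x) x (ℤ.- c) ⟨
      (x ℤ.- c) ℤ.* eval p x                               ∎

    eval-⨁ : ∀ k f x → eval (⨁ k f) x ≡ sum (λ i → eval (f i) x)
    eval-⨁ zero    f x = refl
    eval-⨁ (suc k) f x = trans (eval-⊕ (f zero) (⨁ k (f ∘ suc)) x)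
      (cong (λ y → eval (f zero) x ℤ.+ y) (eval-⨁ k (f ∘ suc) x))

    sum-cong : ∀ k {f g : Fin k → ℤ} → (∀ i → f i ≡ g i) → sum {k} f ≡ sum {k} g
    sum-cong k f≗g = sum-cong-≗ {k} f≗g

    sum-const : ∀ d x → sum {d} (λ _ → x) ≡ (+ d) ℤ.* x
    sum-const zero    x = sym (ℤ.*-zeroˡ x)
    sum-const (suc d) x = trans (cong (λ y → x ℤ.+ y) (sum-const d x)) (sym (ℤ.suc-* (+ d) x))

    sum-split : ∀ m {d} (f : Fin (m ℕ.+ d) → ℤ) →
      sum f ≡ sum (f ∘ (_↑ˡ d)) ℤ.+ sum (f ∘ (m ↑ʳ_))
    sum-split zero    f = sym (ℤ.+-identityˡ _)
    sum-split (suc m) f = trans (cong (λ y → f zero ℤ.+ y) (sum-split m (f ∘ suc)))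
      (sym (ℤ.+-assoc (f zero) _ _))

    sum-combine : ∀ m k (f : Fin (m ℕ.* k) → ℤ) →
      sum f ≡ sum {m} (λ c → sum {k} (λ i → f (combine c i)))
    sum-combine zero    k f = refl
    sum-combine (suc m) k f = trans (sum-split k f)
      (cong (λ y → sum (f ∘ (_↑ˡ (m ℕ.* k))) ℤ.+ y) (sum-combine m k (f ∘ (k ↑ʳ_))))

    -- The sum of Q over all words of length n in the letters 0, …, l − 1.
    wordSum : ∀ n → ℕ → (Vec ℕ n → ℤ) → ℤ
    wordSum zero    l Q = Q []
    wordSum (suc n) l Q = sum {l} (λ c → wordSum n l (Q ∘ (toℕ c ∷_)))

    wordSum-cong : ∀ n l {Q Q′} → (∀ w → Q w ≡ Q′ w) → wordSum n l Q ≡ wordSum n l Q′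
    wordSum-cong zero    l Q≡Q′ = Q≡Q′ []
    wordSum-cong (suc n) l Q≡Q′ = sum-cong l λ c → wordSum-cong n l λ w → Q≡Q′ (toℕ c ∷ w)

    wordSum-finToFun : ∀ n l (Q : Vec ℕ n → ℤ) →
      sum {l ℕ.^ n} (λ i → Q (Vec.tabulate (toℕ ∘ finToFun i))) ≡ wordSum n l Q
    wordSum-finToFun zero    l Q = ℤ.+-identityʳ (Q [])
    wordSum-finToFun (suc n) l Q = trans
      (sum-combine l (l ℕ.^ n) (λ i → Q (Vec.tabulate (toℕ ∘ finToFun i))))
      (sum-cong l λ c → trans
        (sum-cong (l ℕ.^ n) λ i → cong
          (λ (q , r) → Q (toℕ q ∷ Vec.tabulate (toℕ ∘ finToFun r)))
          (Fin.remQuot-combine {l} {l ℕ.^ n} c i))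
        (wordSum-finToFun n l (Q ∘ (toℕ c ∷_))))

    swap : ℕ → ℕ → ℕ → ℕ
    swap a b c = if does (c ℕ.≟ a) then b else if does (c ℕ.≟ b) then a else c

    swap-fix : ∀ a b {c} → c ≢ a → c ≢ b → swap a b c ≡ c
    swap-fix a b {c} c≢a c≢b rewrite dec-false (c ℕ.≟ a) c≢a | dec-false (c ℕ.≟ b) c≢b = refl

    swap-left : ∀ a b → swap a b a ≡ b
    swap-left a b rewrite dec-true (a ℕ.≟ a) refl = refl

    swap-right : ∀ a b → swap a b b ≡ a
    swap-right a b = case (b ℕ.≟ a)
      where
      case : Dec (b ≡ a) → swap a b b ≡ a
      case (yes refl) = swap-left a b
      case (no b≢a) rewrite dec-false (b ℕ.≟ a) b≢a | dec-true (b ℕ.≟ b) refl = refl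

    swap-involutive : ∀ a b c → swap a b (swap a b c) ≡ c
    swap-involutive a b c = case (c ℕ.≟ a) (c ℕ.≟ b)
      where
      case : Dec (c ≡ a) → Dec (c ≡ b) → swap a b (swap a b c) ≡ c
      case (yes refl) _          = trans (cong (swap a b) (swap-left a b)) (swap-right a b)
      case (no _)     (yes refl) = trans (cong (swap a b) (swap-right a b)) (swap-left a b)
      case (no c≢a)   (no c≢b)   = trans (cong (swap a b) (swap-fix a b c≢a c≢b)) (swap-fix a b c≢a c≢b)

    swap-injective : ∀ a b {c d} → swap a b c ≡ swap a b d → c ≡ d
    swap-injective a b {c} {d} eq =
      trans (sym (swap-involutive a b c)) (trans (cong (swap a b) eq) (swap-involutive a b d))

    toℕ-transpose : ∀ {l} (a b c : Fin l) →
      toℕ (Perm.transpose a b Perm.⟨$⟩ʳ c) ≡ swap (toℕ a) (toℕ b) (toℕ c)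
    toℕ-transpose a b c with c Fin.≟ a
    ... | yes refl = sym (swap-left (toℕ a) (toℕ b))
    ... | no c≢a with c Fin.≟ b
    ...   | yes refl = sym (swap-right (toℕ a) (toℕ b))
    ...   | no c≢b = sym (swap-fix (toℕ a) (toℕ b) (c≢a ∘ Fin.toℕ-injective) (c≢b ∘ Fin.toℕ-injective))

    wordSum-swap : ∀ n {l} (a b : Fin l) Q →
      wordSum n l (λ w → Q (Vec.map (swap (toℕ a) (toℕ b)) w)) ≡ wordSum n l Q
    wordSum-swap zero    a b Q = refl
    wordSum-swap (suc n) {l} a b Q = begin
      sum {l} (λ c → wordSum n l (λ w → Q (σ (toℕ c) ∷ Vec.map σ w)))
        ≡⟨ sum-cong l (λ c → wordSum-swap n a b (λ w → Q (σ (toℕ c) ∷ w))) ⟩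
      sum {l} (λ c → wordSum n l (λ w → Q (σ (toℕ c) ∷ w)))
        ≡⟨ sum-cong l (λ c → cong (λ c′ → wordSum n l (λ w → Q (c′ ∷ w))) (toℕ-transpose a b c)) ⟨
      sum {l} (λ c → wordSum n l (λ w → Q (toℕ (Perm.transpose a b Perm.⟨$⟩ʳ c) ∷ w)))
        ≡⟨ sum-permute (λ c → wordSum n l (λ w → Q (toℕ c ∷ w))) (Perm.transpose a b) ⟨
      sum {l} (λ c → wordSum n l (λ w → Q (toℕ c ∷ w)))
        ∎
      where
      σ : ℕ → ℕ
      σ = swap (toℕ a) (toℕ b)

    -- Q does not change under renamings of the letters that fix 0, …, k − 1.
    Symmetric : ∀ {n} → ℕ → (Vec ℕ n → ℤ) → Set
    Symmetric k Q = ∀ (σ : ℕ → ℕ) → (∀ {a b} → σ a ≡ σ b → a ≡ b) →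
      (∀ {a} → a ℕ.< k → σ a ≡ a) → ∀ w → Q (Vec.map σ w) ≡ Q w

    Symmetric-∷ : ∀ {n k m} (Q : Vec ℕ (suc n) → ℤ) {c} → Symmetric k Q →
      k ℕ.≤ m → c ℕ.< m → Symmetric m (Q ∘ (c ∷_))
    Symmetric-∷ Q {c} symQ k≤m c<m σ σ-inj σ-fix w = trans
      (cong (λ c′ → Q (c′ ∷ Vec.map σ w)) (sym (σ-fix c<m)))
      (symQ σ σ-inj (λ a<k → σ-fix (ℕ.<-≤-trans a<k k≤m)) (c ∷ w))

    -- Each letter of the word is either one of the k letters already used, or
    -- one of the X − k unused ones, which are interchangeable.
    wordPolynomial : ∀ n → ℕ → (Vec ℕ n → ℤ) → Polynomial
    wordPolynomial zero    k Q = Q [] ∷ []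
    wordPolynomial (suc n) k Q =
      ⨁ k (λ c → wordPolynomial n k (Q ∘ (toℕ c ∷_)))
        ⊕ (timesX- (+ k)) (wordPolynomial n (suc k) (Q ∘ (k ∷_)))

    fresh : ∀ n k d (Q : Vec ℕ (suc n) → ℤ) → Symmetric k Q → (c : Fin d) →
      wordSum n (k ℕ.+ d) (Q ∘ (toℕ (k ↑ʳ c) ∷_)) ≡ wordSum n (k ℕ.+ d) (Q ∘ (k ∷_))
    fresh n k d@(suc _) Q symQ c = begin
      wordSum n l (Q ∘ (toℕ c₁ ∷_))
        ≡⟨ wordSum-cong n l (λ w → cong (λ c′ → Q (c′ ∷ w)) (sym (swap-left (toℕ c₀) (toℕ c₁)))) ⟩
      wordSum n l (λ w → Q (σ (toℕ c₀) ∷ w))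
        ≡⟨ wordSum-swap n c₀ c₁ (λ w → Q (σ (toℕ c₀) ∷ w)) ⟨
      wordSum n l (λ w → Q (Vec.map σ (toℕ c₀ ∷ w)))
        ≡⟨ wordSum-cong n l (λ w → symQ σ (swap-injective (toℕ c₀) (toℕ c₁)) σ-fix (toℕ c₀ ∷ w)) ⟩
      wordSum n l (λ w → Q (toℕ c₀ ∷ w))
        ≡⟨ cong (λ c′ → wordSum n l (λ w → Q (c′ ∷ w))) toℕ-c₀ ⟩
      wordSum n l (Q ∘ (k ∷_))
        ∎
      where
      l : ℕ
      l = k ℕ.+ d
      c₀ c₁ : Fin l
      c₀ = k ↑ʳ zero
      c₁ = k ↑ʳ c
      σ : ℕ → ℕ
      σ = swap (toℕ c₀) (toℕ c₁)
      toℕ-c₀ : toℕ c₀ ≡ k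
      toℕ-c₀ = trans (Fin.toℕ-↑ʳ k (zero {n = _})) (ℕ.+-identityʳ k)
      σ-fix : ∀ {a} → a ℕ.< k → σ a ≡ a
      σ-fix {a} a<k = swap-fix (toℕ c₀) (toℕ c₁)
        (λ { refl → ℕ.<-irrefl refl (subst (ℕ._< k) toℕ-c₀ a<k) })
        (λ { refl → ℕ.<⇒≱ (subst (ℕ._< k) (Fin.toℕ-↑ʳ k c) a<k) (ℕ.m≤m+n k (toℕ c)) })

    eval-wordPolynomial : ∀ n k d Q → Symmetric k Q →
      eval (wordPolynomial n k Q) (+ (k ℕ.+ d)) ≡ wordSum n (k ℕ.+ d) Q
    eval-wordPolynomial zero    k d Q symQ =
      trans (cong (λ y → Q [] ℤ.+ y) (ℤ.*-zeroʳ (+ (k ℕ.+ d)))) (ℤ.+-identityʳ (Q []))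
    eval-wordPolynomial (suc n) k d Q symQ = begin
      eval (⨁ k old ⊕ (timesX- (+ k)) new) (+ l)
        ≡⟨ eval-⊕ (⨁ k old) ((timesX- (+ k)) new) (+ l) ⟩
      eval (⨁ k old) (+ l) ℤ.+ eval ((timesX- (+ k)) new) (+ l)
        ≡⟨ cong₂ ℤ._+_ (trans (eval-⨁ k old (+ l)) (sum-cong k oldStep)) newStep ⟩
      sum {k} (λ c → wordSum n l (Q ∘ (toℕ (c ↑ˡ d) ∷_)))
        ℤ.+ sum {d} (λ c → wordSum n l (Q ∘ (toℕ (k ↑ʳ c) ∷_)))
        ≡⟨ sum-split k (λ c → wordSum n l (Q ∘ (toℕ c ∷_))) ⟨
      wordSum (suc n) l Q
        ∎
      where
      l : ℕ
      l = k ℕ.+ d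
      old : Fin k → Polynomial
      old c = wordPolynomial n k (Q ∘ (toℕ c ∷_))
      new : Polynomial
      new = wordPolynomial n (suc k) (Q ∘ (k ∷_))
      oldStep : ∀ c → eval (old c) (+ l) ≡ wordSum n l (Q ∘ (toℕ (c ↑ˡ d) ∷_))
      oldStep c = trans
        (eval-wordPolynomial n k d (Q ∘ (toℕ c ∷_)) (Symmetric-∷ Q symQ ℕ.≤-refl (Fin.toℕ<n c)))
        (cong (λ c′ → wordSum n l (Q ∘ (c′ ∷_))) (sym (Fin.toℕ-↑ˡ c d)))
      l-k≡d : + l ℤ.- + k ≡ + d
      l-k≡d = solve 2 (λ k d → (k :+ d) :- k := d) refl (+ k) (+ d)
      newEval : ∀ d → (+ d) ℤ.* eval new (+ (k ℕ.+ d)) ≡ (+ d) ℤ.* wordSum n (k ℕ.+ d) (Q ∘ (k ∷_))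
      newEval zero    = trans (ℤ.*-zeroˡ (eval new (+ (k ℕ.+ 0)))) (sym (ℤ.*-zeroˡ (wordSum n (k ℕ.+ 0) (Q ∘ (k ∷_)))))
      newEval (suc d) = cong ((+ suc d) ℤ.*_)
        (subst (λ m → eval new (+ m) ≡ wordSum n m (Q ∘ (k ∷_))) (sym (ℕ.+-suc k d))
          (eval-wordPolynomial n (suc k) d (Q ∘ (k ∷_)) (Symmetric-∷ Q symQ (ℕ.n≤1+n k) ℕ.≤-refl)))
      newStep : eval ((timesX- (+ k)) new) (+ l) ≡ sum {d} (λ c → wordSum n l (Q ∘ (toℕ (k ↑ʳ c) ∷_)))
      newStep = begin
        eval ((timesX- (+ k)) new) (+ l)                  ≡⟨ eval-timesX- (+ k) new (+ l) ⟩
        (+ l ℤ.- + k) ℤ.* eval new (+ l)                  ≡⟨ cong (ℤ._* eval new (+ l)) l-k≡d ⟩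
        (+ d) ℤ.* eval new (+ l)                          ≡⟨ newEval d ⟩
        (+ d) ℤ.* wordSum n l (Q ∘ (k ∷_))                ≡⟨ sum-const d _ ⟨
        sum {d} (λ _ → wordSum n l (Q ∘ (k ∷_)))          ≡⟨ sum-cong d (fresh n k d Q symQ) ⟨
        sum {d} (λ c → wordSum n l (Q ∘ (toℕ (k ↑ʳ c) ∷_))) ∎

    indicator : ∀ {P : Set} → Dec P → ℤ
    indicator P? = if does P? then 1ℤ else 0ℤ

    indicator-⇔ : ∀ {P P′ : Set} → (P → P′) → (P′ → P) → (P? : Dec P) (P′? : Dec P′) →
      indicator P? ≡ indicator P′?
    indicator-⇔ f g (yes p) (yes _)  = refl
    indicator-⇔ f g (yes p) (no ¬p′) = contradiction (f p) ¬p′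
    indicator-⇔ f g (no ¬p) (yes p′) = contradiction (g p′) ¬p
    indicator-⇔ f g (no _)  (no _)   = refl

    length-filter : ∀ {A : Set} {P : Pred A 0ℓ} (P? : Decidable P) {m} (f : Fin m → A) →
      + length (filter P? (tabulate f)) ≡ sum (λ i → indicator (P? (f i)))
    length-filter P? {zero}  f = refl
    length-filter P? {suc m} f with P? (f zero)
    ... | yes _ = cong (λ y → 1ℤ ℤ.+ y) (length-filter P? (f ∘ suc))
    ... | no  _ = trans (length-filter P? (f ∘ suc)) (sym (ℤ.+-identityˡ _))

    Proper-kernel : ∀ H {A B : Set} (π : Fin (order H) → A) (ρ : Fin (order H) → B) →
      (∀ x y → π x ≡ π y → ρ x ≡ ρ y) → Proper H ρ → Proper H π
    Proper-kernel H π ρ ker proper e e∈E with proper e e∈E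
    ... | x , y , x∈e , y∈e , ρx≢ρy = x , y , x∈e , y∈e , ρx≢ρy ∘ ker x y

    properIndicator : ∀ H → Vec ℕ (order H) → ℤ
    properIndicator H w = indicator (proper? H ℕ._≟_ (lookup w))

    properIndicator-symmetric : ∀ H → Symmetric 0 (properIndicator H)
    properIndicator-symmetric H σ σ-inj _ w = indicator-⇔
      (Proper-kernel H (lookup w) (lookup (Vec.map σ w)) λ x y eq →
        trans (Vec.lookup-map x σ w) (trans (cong σ eq) (sym (Vec.lookup-map y σ w))))
      (Proper-kernel H (lookup (Vec.map σ w)) (lookup w) λ x y eq →
        σ-inj (trans (sym (Vec.lookup-map x σ w)) (trans eq (Vec.lookup-map y σ w))))
      (proper? H ℕ._≟_ (lookup (Vec.map σ w))) (proper? H ℕ._≟_ (lookup w))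

    #properColourings≡wordSum : ∀ H l →
      + #properColourings H l ≡ wordSum (order H) l (properIndicator H)
    #properColourings≡wordSum H l = begin
      + #properColourings H l
        ≡⟨ length-filter (λ i → proper? H Fin._≟_ (finToFun i)) {l ℕ.^ order H} (λ i → i) ⟩
      sum {l ℕ.^ order H} (λ i → indicator (proper? H Fin._≟_ (finToFun i)))
        ≡⟨ sum-cong (l ℕ.^ order H) (λ i → sameKernel (finToFun i)) ⟩
      sum {l ℕ.^ order H} (λ i → properIndicator H (Vec.tabulate (toℕ ∘ finToFun i)))
        ≡⟨ wordSum-finToFun (order H) l (properIndicator H) ⟩
      wordSum (order H) l (properIndicator H)
        ∎
      where
      sameKernel : (π : Fin (order H) → Fin l) →
        indicator (proper? H Fin._≟_ π) ≡ properIndicator H (Vec.tabulate (toℕ ∘ π))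
      sameKernel π = indicator-⇔
        (Proper-kernel H (lookup w) π λ x y eq → Fin.toℕ-injective
          (trans (sym (Vec.lookup∘tabulate (toℕ ∘ π) x)) (trans eq (Vec.lookup∘tabulate (toℕ ∘ π) y))))
        (Proper-kernel H π (lookup w) λ x y eq →
          trans (Vec.lookup∘tabulate (toℕ ∘ π) x) (trans (cong toℕ eq) (sym (Vec.lookup∘tabulate (toℕ ∘ π) y))))
        (proper? H Fin._≟_ π) (proper? H ℕ._≟_ (lookup w))
        where
        w : Vec ℕ (order H)
        w = Vec.tabulate (toℕ ∘ π)

  chromaticPolynomial : Hypergraph → Polynomial
  chromaticPolynomial H = wordPolynomial (order H) 0 (properIndicator H)

  chromaticPolynomial-counts : ∀ H → IsChromaticPolynomial H (chromaticPolynomial H)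
  chromaticPolynomial-counts H l = trans
    (eval-wordPolynomial (order H) 0 l (properIndicator H) (properIndicator-symmetric H))
    (sym (#properColourings≡wordSum H l))

  a₁ : Hypergraph → ℤ
  a₁ H = coefficient (chromaticPolynomial H) 1

module TaylorRoots where

  open ComplexNumbers using (ℂ; fromℚ; ℂ-commutativeRing)
  open CommutativeRing ℂ-commutativeRing hiding (zero; refl; sym; trans)
  open Algebra.Definitions _≈_ using (Invertible)
  open Exp semiring using (_^_)
  open Sum +-commutativeMonoid using (sum-syntax; sum⁺-syntax)

  private
    module C = CommutativeRing ℂ-commutativeRing
    open Algebra.Properties.Ring ring using (-‿distribˡ-*; -‿distribʳ-*)
    module + = Sum +-commutativeMonoid
    module * = Sum *-commutativeMonoid

  ∏ : ∀ {m} → (Fin m → ℂ) → ℂ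
  ∏ = *.sum

  infix 9 1/_!
  1/_! : ℕ → ℚ
  1/ k ! = (+ 1 ℚ./ k !) {{ℕ._!≢0 k}}

  E : ℕ → ℂ → ℂ
  E m x = ∑[ k ≤ m ] (fromℚ (1/ toℕ k !) * x ^ toℕ k)

  -- R lists the m roots of E m with multiplicity: E m is its leading
  -- coefficient 1/m! times the product of the linear factors x − R i.
  record AreRootsOfE (m : ℕ) (R : Fin m → ℂ) : Set where
    field
      splits : ∀ x → E m x ≈ fromℚ (1/ m !) * ∏ (λ i → x - R i)

  private
    open SetoidReasoning setoid

    E-zero : ∀ m → E m 0# ≈ 1#
    E-zero m = begin
      1# * 1# + +.sum {m} (λ k → fromℚ (1/ suc (toℕ k) !) * (0# * 0# ^ toℕ k))
        ≈⟨ +-cong (*-identityˡ 1#) (+.sum-cong-≋ {m} λ k →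
             C.trans (*-congˡ (zeroˡ (0# ^ toℕ k))) (zeroʳ (fromℚ (1/ suc (toℕ k) !)))) ⟩
      1# + +.sum {m} (λ _ → 0#)
        ≈⟨ +-congˡ (+.sum-replicate-zero m) ⟩
      1# + 0#
        ≈⟨ +-identityʳ 1# ⟩
      1#
        ∎

    factor : ∀ {m} (f : Fin m → ℂ) i → ∃[ q ] ∏ f ≈ f i * q
    factor {suc m} f i = *.sum (λ j → f (Fin.punchIn i j)) , *.sum-remove {i = i} f

  -- Since E m 0 = 1; constructively a reciprocal requires such a witness.
  root-invertible : ∀ m R → AreRootsOfE m R → ∀ i → Invertible 1# _*_ (R i)
  root-invertible m R roots i = R⁻¹ , C.trans (*-comm R⁻¹ (R i)) inverse , inverse
    where
    c q R⁻¹ : ℂ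
    c = fromℚ (1/ m !)
    q = proj₁ (factor (λ j → 0# - R j) i)
    R⁻¹ = - (c * q)

    inverse : R i * R⁻¹ ≈ 1#
    inverse = begin
      R i * - (c * q)            ≈⟨ -‿distribʳ-* (R i) (c * q) ⟨
      - (R i * (c * q))          ≈⟨ -‿distribˡ-* (R i) (c * q) ⟩
      - R i * (c * q)            ≈⟨ *-congʳ (+-identityˡ (- R i)) ⟨
      (0# - R i) * (c * q)       ≈⟨ *-assoc (0# - R i) c q ⟨
      (0# - R i) * c * q         ≈⟨ *-congʳ (*-comm (0# - R i) c) ⟩
      c * (0# - R i) * q         ≈⟨ *-assoc c (0# - R i) q ⟩
      c * ((0# - R i) * q)       ≈⟨ *-congˡ (proj₂ (factor (λ j → 0# - R j) i)) ⟨
      c * ∏ (λ j → 0# - R j)     ≈⟨ AreRootsOfE.splits roots 0# ⟨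
      E m 0#                     ≈⟨ E-zero m ⟩
      1#                         ∎

  rootInverse : ∀ {m R} → AreRootsOfE m R → Fin m → ℂ
  rootInverse {m} {R} roots i = proj₁ (root-invertible m R roots i)

  μ : ∀ {m R} → AreRootsOfE m R → ℕ → ℂ
  μ {m} roots n = ∑[ i < m ] (rootInverse roots i ^ n)

  fromℤ : ℤ → ℂ
  fromℤ z = fromℚ (z ℚ./ 1)

{-# OPTIONS --safe #-}

-- Colouring n vertices with l colours so that no colour is used r or more
-- times is counted by n! [xⁿ] Eₘ(x)ˡ with m = r − 1. The part of Eₘˡ linear in l
-- is log Eₘ = Σᵢ log (1 − x / Rᵢ), where n! [xⁿ] gives −(n−1)! Σᵢ Rᵢ⁻ⁿ. To avoid
-- logarithms, compare logarithmic derivatives: if c is the linear part of Eₘˡ,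
-- then Eₘ c′ = Eₘ′ = Eₘ · Σᵢ −Rᵢ⁻¹ / (1 − x / Rᵢ), and Eₘ is invertible.
module Submission where

open import Defs
open import Algebra.Bundles using (CommutativeRing)
import Algebra.Properties.CommutativeMonoid.Mult as CommutativeMonoidMult
import Algebra.Properties.CommutativeMonoid.Sum as Sum
import Algebra.Properties.Ring
import Algebra.Properties.Semiring.Exp as Exp
import Algebra.Properties.Semiring.Mult as Mult
import Algebra.Properties.Semiring.Sum as SemiringSum
import Algebra.Solver.Ring.NaturalCoefficients.Default as Solver
open import Data.Bool.Base using (true; false; if_then_else_)
open import Data.Fin.Base using (Fin; zero; suc; toℕ; _↑ˡ_; _↑ʳ_; combine; finToFun)
import Data.Fin.Properties as Fin
open import Data.Fin.Subset using (Subset; _⊆_; _∈_; ⊥; Nonempty) renaming (∣_∣ to size)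
import Data.Fin.Subset.Properties as Subset
open import Data.Integer.Base as ℤ using (+_; 1ℤ)
import Data.Integer.Properties as ℤ
open import Data.List.Base using (List; []; _∷_; map; length; filter; tabulate)
open import Data.Nat.Base as ℕ using (ℕ; zero; suc; _≤_; _<_; z≤n; s≤s; _∸_; _!)
import Data.Nat.Properties as ℕ
open import Data.Product.Base using (_×_; _,_; proj₂; ∃-syntax)
open import Data.Rational.Base as ℚ using (1ℚ; toℚᵘ)
import Data.Rational.Properties as ℚ
open import Data.Rational.Unnormalised.Base as ℚᵘ using (mkℚᵘ; *≡*)
import Data.Rational.Unnormalised.Properties as ℚᵘ
open import Data.Vec.Base as Vec using ()
open import Data.Vec.Functional using (updateAt)
open import Data.Vec.Functional.Properties using (updateAt-updates; updateAt-minimal)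
import Data.Vec.Properties as Vec
open import Function.Base using (_∘_)
open import Level using (0ℓ)
open import Relation.Binary.PropositionalEquality as ≡ using (_≡_)
import Relation.Binary.Reasoning.Setoid as SetoidReasoning
open import Relation.Nullary.Decidable
  using (Dec; yes; no; does; dec-true; ¬?; _×-dec_; decidable-stable)
open import Relation.Nullary.Negation using (¬_; contradiction)
open import Relation.Unary using (Pred; Decidable)
open Hypergraphs using (K; Proper; proper?; #properColourings)

-- The chromatic polynomial is known only through its values at natural numbers, and the
-- factorisation of Eₘ only through its values at complex points, while the comparison of
-- logarithmic derivatives concerns coefficients. One principle bridges both gaps: a polynomial
-- vanishing at all natural numbers has zero coefficients. Equality of constructive complex numbers
-- is undecidable, so roots are not counted as over a discrete field; dividing successively by X - N
-- for N = 0, 1, 2, ... only requires cancelling positive integers. The linear part comes from f ·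
-- (fˡ)′ = l · f′ · fˡ, read as an identity between polynomials in l: the coefficient of l is f · c′
-- on the left, and on the right f′ times the constant part of fˡ, which is f⁰ = 1. Recording n!
-- [xⁿ] instead of [xⁿ] keeps the ring of series free of division: differentiation is a shift, the
-- numbers counted are themselves the coefficients, and Eₘ becomes a sequence of ones and zeros.

-- The sequence f stands for the exponential generating function Σ f(n) xⁿ / n!.
module Hurwitz {c ℓ} (A : CommutativeRing c ℓ) where

  open CommutativeRing A hiding (zero)
  open SetoidReasoning setoid
  open Mult semiring using () renaming (_×_ to _·_)
  open Solver commutativeSemiring using (solve; _:=_; _:+_; _:*_)

  Series : Set c
  Series = ℕ → Carrier

  infix 4 _≋_
  record _≋_ (f g : Series) : Set ℓ where
    constructor mk≋
    field
      at : ∀ n → f n ≈ g n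
  open _≋_ public

  ∂ : Series → Series
  ∂ f = f ∘ suc

  const : Carrier → Series
  const a zero    = a
  const a (suc n) = 0#

  0ˢ 1ˢ : Series
  0ˢ n = 0#
  1ˢ   = const 1#

  infixl 6 _+ˢ_
  infixl 7 _*ˢ_
  infix  8 -ˢ_

  -- The Leibniz rule taken as a definition. It unfolds to the binomial convolution Σ C(n,k) f(k)
  -- g(n-k), the product of exponential generating functions, with no binomial coefficients to
  -- handle.
  _+ˢ_ _*ˢ_ : Series → Series → Series
  (f +ˢ g) n       = f n + g n
  (f *ˢ g) zero    = f 0 * g 0
  (f *ˢ g) (suc n) = (∂ f *ˢ g) n + (f *ˢ ∂ g) n

  -ˢ_ : Series → Series
  (-ˢ f) n = - f n

  private

    *ˢ-cong : ∀ n {f g h k} → f ≋ g → h ≋ k → (f *ˢ h) n ≈ (g *ˢ k) n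
    *ˢ-cong zero    f≋g h≋k = *-cong (at f≋g 0) (at h≋k 0)
    *ˢ-cong (suc n) f≋g h≋k = +-cong
      (*ˢ-cong n (mk≋ (at f≋g ∘ suc)) h≋k) (*ˢ-cong n f≋g (mk≋ (at h≋k ∘ suc)))

    *ˢ-comm : ∀ n f g → (f *ˢ g) n ≈ (g *ˢ f) n
    *ˢ-comm zero    f g = *-comm (f 0) (g 0)
    *ˢ-comm (suc n) f g =
      trans (+-cong (*ˢ-comm n (∂ f) g) (*ˢ-comm n f (∂ g))) (+-comm _ _)

    *ˢ-distribˡ : ∀ n f g h → (f *ˢ (g +ˢ h)) n ≈ (f *ˢ g) n + (f *ˢ h) n
    *ˢ-distribˡ zero    f g h = distribˡ (f 0) (g 0) (h 0)
    *ˢ-distribˡ (suc n) f g h =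
      trans (+-cong (*ˢ-distribˡ n (∂ f) g h) (*ˢ-distribˡ n f (∂ g) (∂ h)))
        (solve 4 (λ a b c d → (a :+ b) :+ (c :+ d) := (a :+ c) :+ (b :+ d)) refl _ _ _ _)

    *ˢ-distribʳ : ∀ n f g h → ((g +ˢ h) *ˢ f) n ≈ (g *ˢ f) n + (h *ˢ f) n
    *ˢ-distribʳ n f g h = trans (*ˢ-comm n (g +ˢ h) f)
      (trans (*ˢ-distribˡ n f g h) (+-cong (*ˢ-comm n f g) (*ˢ-comm n f h)))

    *ˢ-assoc : ∀ n f g h → ((f *ˢ g) *ˢ h) n ≈ (f *ˢ (g *ˢ h)) n
    *ˢ-assoc zero    f g h = *-assoc (f 0) (g 0) (h 0)
    *ˢ-assoc (suc n) f g h = begin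
      ((∂ f *ˢ g +ˢ f *ˢ ∂ g) *ˢ h) n + ((f *ˢ g) *ˢ ∂ h) n
        ≈⟨ +-congʳ (*ˢ-distribʳ n h (∂ f *ˢ g) (f *ˢ ∂ g)) ⟩
      (((∂ f *ˢ g) *ˢ h) n + ((f *ˢ ∂ g) *ˢ h) n) + ((f *ˢ g) *ˢ ∂ h) n
        ≈⟨ +-cong (+-cong (*ˢ-assoc n (∂ f) g h) (*ˢ-assoc n f (∂ g) h)) (*ˢ-assoc n f g (∂ h)) ⟩
      ((∂ f *ˢ (g *ˢ h)) n + (f *ˢ (∂ g *ˢ h)) n) + (f *ˢ (g *ˢ ∂ h)) n
        ≈⟨ +-assoc _ _ _ ⟩
      (∂ f *ˢ (g *ˢ h)) n + ((f *ˢ (∂ g *ˢ h)) n + (f *ˢ (g *ˢ ∂ h)) n)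
        ≈⟨ +-congˡ (*ˢ-distribˡ n f (∂ g *ˢ h) (g *ˢ ∂ h)) ⟨
      (∂ f *ˢ (g *ˢ h)) n + (f *ˢ (∂ g *ˢ h +ˢ g *ˢ ∂ h)) n
        ∎

    *ˢ-zeroˡ : ∀ n f → (0ˢ *ˢ f) n ≈ 0#
    *ˢ-zeroˡ zero    f = zeroˡ (f 0)
    *ˢ-zeroˡ (suc n) f = trans (+-cong (*ˢ-zeroˡ n f) (*ˢ-zeroˡ n (∂ f))) (+-identityˡ 0#)

  const-* : ∀ a f n → (const a *ˢ f) n ≈ a * f n
  const-* a f zero    = refl
  const-* a f (suc n) = trans (+-cong (*ˢ-zeroˡ n f) (const-* a (∂ f) n)) (+-identityˡ _)

  private

    *ˢ-identityˡ : ∀ n f → (1ˢ *ˢ f) n ≈ f n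
    *ˢ-identityˡ n f = trans (const-* 1# f n) (*-identityˡ (f n))

  series-commutativeRing : CommutativeRing c ℓ
  series-commutativeRing = record
    { Carrier = Series
    ; _≈_ = _≋_
    ; _+_ = _+ˢ_
    ; _*_ = _*ˢ_
    ; -_ = -ˢ_
    ; 0# = 0ˢ
    ; 1# = 1ˢ
    ; isCommutativeRing = record
      { isRing = record
        { +-isAbelianGroup = record
          { isGroup = record
            { isMonoid = record
              { isSemigroup = record
                { isMagma = record
                  { isEquivalence = record
                    { refl = mk≋ λ _ → refl
                    ; sym = λ p → mk≋ λ n → sym (at p n)
                    ; trans = λ p q → mk≋ λ n → trans (at p n) (at q n)
                    }
                  ; ∙-cong = λ p q → mk≋ λ n → +-cong (at p n) (at q n)
                  }
                ; assoc = λ f g h → mk≋ λ n → +-assoc (f n) (g n) (h n)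
                }
              ; identity = (λ f → mk≋ λ n → +-identityˡ (f n)) , (λ f → mk≋ λ n → +-identityʳ (f n))
              }
            ; inverse = (λ f → mk≋ λ n → -‿inverseˡ (f n)) , (λ f → mk≋ λ n → -‿inverseʳ (f n))
            ; ⁻¹-cong = λ p → mk≋ λ n → -‿cong (at p n)
            }
          ; comm = λ f g → mk≋ λ n → +-comm (f n) (g n)
          }
        ; *-cong = λ p q → mk≋ λ n → *ˢ-cong n p q
        ; *-assoc = λ f g h → mk≋ λ n → *ˢ-assoc n f g h
        ; *-identity = (λ f → mk≋ λ n → *ˢ-identityˡ n f)
                     , (λ f → mk≋ λ n → trans (*ˢ-comm n f 1ˢ) (*ˢ-identityˡ n f))
        ; distrib = (λ f g h → mk≋ λ n → *ˢ-distribˡ n f g h)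
                  , (λ f g h → mk≋ λ n → *ˢ-distribʳ n f g h)
        }
      ; *-comm = λ f g → mk≋ λ n → *ˢ-comm n f g
      }
    }

  private
    module H = CommutativeRing series-commutativeRing
    module ∑ = SemiringSum semiring
    module ∑ˢ = SemiringSum H.semiring
    module ∏ˢ = Sum H.*-commutativeMonoid
    module ∏ = Sum *-commutativeMonoid

  ∑ˢ : ∀ {l} → (Fin l → Series) → Series
  ∑ˢ = ∑ˢ.sum

  ∏ˢ : ∀ {l} → (Fin l → Series) → Series
  ∏ˢ = ∏ˢ.sum

  ∑ˢ-at : ∀ {l} (f : Fin l → Series) n → ∑ˢ f n ≈ ∑.sum (λ i → f i n)
  ∑ˢ-at {zero}  f n = refl
  ∑ˢ-at {suc l} f n = +-congˡ (∑ˢ-at (f ∘ suc) n)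

  ∏ˢ-at-0 : ∀ {l} (f : Fin l → Series) → ∏ˢ f 0 ≈ ∏.sum (λ i → f i 0)
  ∏ˢ-at-0 {zero}  f = refl
  ∏ˢ-at-0 {suc l} f = *-congˡ (∏ˢ-at-0 (f ∘ suc))

  -- The product rule in the form that matches colouring: a family with member `c` differentiated is
  -- what remains once a vertex has received colour `c`.
  ∂-∏ : ∀ {l} (f : Fin l → Series) → ∂ (∏ˢ f) ≋ ∑ˢ (λ c → ∏ˢ (updateAt f c ∂))
  ∂-∏ {zero}  f = mk≋ λ _ → refl
  ∂-∏ {suc l} f = H.+-congˡ {x = ∂ (f zero) *ˢ ∏ˢ (f ∘ suc)}
    (H.trans (H.*-congˡ {x = f zero} (∂-∏ (f ∘ suc)))
      (∑ˢ.*-distribˡ-sum (f zero) (λ c → ∏ˢ (updateAt (f ∘ suc) c ∂))))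

  private
    const-0 : const 0# ≋ 0ˢ
    const-0 = mk≋ λ { zero → refl ; (suc n) → refl }

    const-+ : ∀ a b → const (a + b) ≋ const a +ˢ const b
    const-+ a b = mk≋ λ { zero → refl ; (suc n) → sym (+-identityˡ 0#) }

  -- The extra factor `f` avoids the exponent l - 1, so the identity includes l = 0 and its right
  -- side is visibly l times an expression in fˡ.
  ∂-power : ∀ f l →
    f *ˢ ∂ (∏ˢ {l} (λ _ → f)) ≋ const (l · 1#) *ˢ (∂ f *ˢ ∏ˢ {l} (λ _ → f))
  ∂-power f zero    = H.trans (H.zeroʳ f) (H.sym
    (H.trans (H.*-congʳ {x = ∂ f *ˢ 1ˢ} const-0) (H.zeroˡ (∂ f *ˢ 1ˢ))))
  ∂-power f (suc l) = H≈.begin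
    f *ˢ (∂ f *ˢ P +ˢ f *ˢ ∂ P)
      H≈.≈⟨ H.distribˡ f (∂ f *ˢ P) (f *ˢ ∂ P) ⟩
    f *ˢ (∂ f *ˢ P) +ˢ f *ˢ (f *ˢ ∂ P)
      H≈.≈⟨ H.+-congˡ {x = f *ˢ (∂ f *ˢ P)} (H.*-congˡ {x = f} (∂-power f l)) ⟩
    f *ˢ (∂ f *ˢ P) +ˢ f *ˢ (const (l · 1#) *ˢ (∂ f *ˢ P))
      H≈.≈⟨ HS.solve 4 (λ f ∂f P k →
              f HS.:* (∂f HS.:* P) HS.:+ f HS.:* (k HS.:* (∂f HS.:* P))
                HS.:= (HS.con 1 HS.:+ k) HS.:* (∂f HS.:* (f HS.:* P)))
              H.refl f (∂ f) P (const (l · 1#)) ⟩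
    (1ˢ +ˢ const (l · 1#)) *ˢ (∂ f *ˢ (f *ˢ P))
      H≈.≈⟨ H.*-congʳ {x = ∂ f *ˢ (f *ˢ P)} (H.sym (const-+ 1# (l · 1#))) ⟩
    const (suc l · 1#) *ˢ (∂ f *ˢ (f *ˢ P))
      H≈.∎
    where
    module H≈ = SetoidReasoning H.setoid
    module HS = Solver H.commutativeSemiring
    P : Series
    P = ∏ˢ {l} (λ _ → f)

-- Summing over all maps by the sizes of their fibres

colourClass : ∀ {n l} → (Fin n → Fin l) → Fin l → Subset n
colourClass π c = Vec.tabulate (λ x → does (π x Fin.≟ c))

module ExponentialFormula {c ℓ} (A : CommutativeRing c ℓ) where

  open CommutativeRing A hiding (zero)
  open Hurwitz A
  open SetoidReasoning setoid
  open SemiringSum semiring using (sum; sum-cong-≋)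
  private
    module ∏ = Sum *-commutativeMonoid

  private

    sum-split : ∀ m {d} (f : Fin (m ℕ.+ d) → Carrier) →
      sum f ≈ sum (f ∘ (_↑ˡ d)) + sum (f ∘ (m ↑ʳ_))
    sum-split zero    f = sym (+-identityˡ _)
    sum-split (suc m) f = trans (+-congˡ (sum-split m (f ∘ suc))) (sym (+-assoc (f zero) _ _))

    sum-combine : ∀ m k (f : Fin (m ℕ.* k) → Carrier) →
      sum f ≈ sum {m} (λ c → sum {k} (λ i → f (combine c i)))
    sum-combine zero    k f = refl
    sum-combine (suc m) k f =
      trans (sum-split k f) (+-congˡ (sum-combine m k (f ∘ (k ↑ʳ_))))

    -- A new vertex of colour `q` enlarges class `q` alone, and raising the index of a series by one
    -- is differentiation.
    add-point : ∀ {n l} (f : Fin l → Series) (p : Fin l → Subset n) q c →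
      f c (size (does (q Fin.≟ c) Vec.∷ p c)) ≡ updateAt f q ∂ c (size (p c))
    add-point f p q c with q Fin.≟ c
    ... | yes ≡.refl = ≡.sym (≡.cong (λ g → g (size (p q))) (updateAt-updates q f))
    ... | no q≢c     =
      ≡.sym (≡.cong (λ g → g (size (p c))) (updateAt-minimal c q f (q≢c ∘ ≡.sym)))

  weight : ∀ {n l} → (Fin l → Series) → (Fin n → Fin l) → Carrier
  weight f π = ∏.sum (λ c → f c (size (colourClass π c)))

  -- Summing over the colour `q` of the first vertex reproduces the product rule. The induction
  -- replaces `f` by `updateAt f q ∂`, hence families of different series, even though a constant
  -- family is what gets counted later.
  exponential-formula : ∀ n {l} (f : Fin l → Series) →
    sum {l ℕ.^ n} (λ i → weight f (finToFun {l} {n} i)) ≈ ∏ˢ f n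
  exponential-formula zero    f = trans (+-identityʳ _) (sym (∏ˢ-at-0 f))
  exponential-formula (suc n) {l} f = begin
    sum {l ℕ.^ suc n} (λ i → weight f (finToFun {l} {suc n} i))
      ≈⟨ sum-combine l (l ℕ.^ n) (λ i → weight f (finToFun {l} {suc n} i)) ⟩
    sum {l} (λ q → sum {l ℕ.^ n} (λ j → weight f (finToFun {l} {suc n} (combine q j))))
      ≈⟨ sum-cong-≋ {l} (λ q → trans (sum-cong-≋ {l ℕ.^ n} (recolour q))
           (exponential-formula n (updateAt f q ∂))) ⟩
    sum {l} (λ q → ∏ˢ (updateAt f q ∂) n)
      ≈⟨ ∑ˢ-at (λ q → ∏ˢ (updateAt f q ∂)) n ⟨
    ∑ˢ (λ q → ∏ˢ (updateAt f q ∂)) n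
      ≈⟨ at (∂-∏ f) n ⟨
    ∏ˢ f (suc n)
      ∎
    where
    recolour : ∀ q j → weight f (finToFun {l} {suc n} (combine q j))
                     ≈ weight (updateAt f q ∂) (finToFun {l} {n} j)
    recolour q j = begin
      weight f (finToFun {l} {suc n} (combine q j))
        -- The code `combine q j` decodes to colour `q` for the first vertex and the map coded by
        -- `j` on the others.
        ≡⟨ ≡.cong
             (λ (q , j) → ∏.sum (λ c →
               f c (size (does (q Fin.≟ c) Vec.∷ colourClass (finToFun {l} {n} j) c))))
             (Fin.remQuot-combine {l} {l ℕ.^ n} q j) ⟩
      ∏.sum (λ c → f c (size (does (q Fin.≟ c) Vec.∷ colourClass (finToFun {l} {n} j) c)))
        ≈⟨ ∏.sum-cong-≋ (λ c → reflexive (add-point f (colourClass (finToFun {l} {n} j)) q c)) ⟩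
      weight (updateAt f q ∂) (finToFun {l} {n} j)
        ∎

-- Polynomials determined by values at natural numbers; the linear part of a power

module ListPolynomials {c ℓ} (A : CommutativeRing c ℓ) where

  open CommutativeRing A hiding (zero)
  open Algebra.Properties.Ring ring
  open Hurwitz A
  open SetoidReasoning setoid
  open Mult semiring renaming (_×_ to _·_)
  open Exp semiring using (_^_)
  open Solver commutativeSemiring using (solve; _:=_; _:+_; _:*_)
  open CommutativeMonoidMult +-commutativeMonoid using (×-distrib-+)
  private
    module ∏ = Sum *-commutativeMonoid

  Poly : Set c
  Poly = List Carrier

  coef : Poly → ℕ → Carrier
  coef []      _       = 0#
  coef (a ∷ p) zero    = a
  coef (a ∷ p) (suc i) = coef p i

  eval : Poly → Carrier → Carrier
  eval []      x = 0#
  eval (a ∷ p) x = a + x * eval p x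

  infixl 6 _⊕_
  _⊕_ : Poly → Poly → Poly
  []      ⊕ q       = q
  (a ∷ p) ⊕ []      = a ∷ p
  (a ∷ p) ⊕ (b ∷ q) = (a + b) ∷ (p ⊕ q)

  scale : Carrier → Poly → Poly
  scale a = map (a *_)

  coef-⊕ : ∀ i p q → coef (p ⊕ q) i ≈ coef p i + coef q i
  coef-⊕ i       []      q       = sym (+-identityˡ _)
  coef-⊕ i       (a ∷ p) []      = sym (+-identityʳ _)
  coef-⊕ zero    (a ∷ p) (b ∷ q) = refl
  coef-⊕ (suc i) (a ∷ p) (b ∷ q) = coef-⊕ i p q

  coef-scale : ∀ i a p → coef (scale a p) i ≈ a * coef p i
  coef-scale i       a []      = sym (zeroʳ a)
  coef-scale zero    a (b ∷ p) = refl
  coef-scale (suc i) a (b ∷ p) = coef-scale i a p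

  eval-⊕ : ∀ x p q → eval (p ⊕ q) x ≈ eval p x + eval q x
  eval-⊕ x []      q       = sym (+-identityˡ _)
  eval-⊕ x (a ∷ p) []      = sym (+-identityʳ _)
  eval-⊕ x (a ∷ p) (b ∷ q) = trans (+-congˡ (*-congˡ (eval-⊕ x p q)))
    (solve 5 (λ a b x p q → (a :+ b) :+ x :* (p :+ q) := (a :+ x :* p) :+ (b :+ x :* q))
      refl a b x (eval p x) (eval q x))

  eval-scale : ∀ x a p → eval (scale a p) x ≈ a * eval p x
  eval-scale x a []      = sym (zeroʳ a)
  eval-scale x a (b ∷ p) = trans (+-congˡ (*-congˡ (eval-scale x a p)))
    (solve 4 (λ a b x p → a :* b :+ x :* (a :* p) := a :* (b :+ x :* p)) refl a b x (eval p x))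

  coef-0 : ∀ p → coef p 0 ≈ eval p 0#
  coef-0 []      = refl
  coef-0 (a ∷ p) = sym (trans (+-congˡ (zeroˡ _)) (+-identityʳ a))

  eval-congˡ : ∀ p {x y} → x ≈ y → eval p x ≈ eval p y
  eval-congˡ []      x≈y = refl
  eval-congˡ (a ∷ p) x≈y = +-congˡ (*-cong x≈y (eval-congˡ p x≈y))

  private

    eval-zero : ∀ p x → (∀ i → coef p i ≈ 0#) → eval p x ≈ 0#
    eval-zero []      x p≈0 = refl
    eval-zero (a ∷ p) x p≈0 =
      trans (+-cong (p≈0 0) (trans (*-congˡ (eval-zero p x (p≈0 ∘ suc))) (zeroʳ x))) (+-identityˡ 0#)

    -- suffixes p a is the quotient of a polynomial b ∷ p by X − a (Horner's scheme).
    suffixes : Poly → Carrier → Poly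
    suffixes []      a = []
    suffixes (b ∷ p) a = eval (b ∷ p) a ∷ suffixes p a

    length-suffixes : ∀ p a → length (suffixes p a) ≡ length p
    length-suffixes []      a = ≡.refl
    length-suffixes (b ∷ p) a = ≡.cong suc (length-suffixes p a)

    -- Division with remainder by X - a, with the argument written `a + d`: no subtraction occurs,
    -- so the identity holds by semiring laws.
    eval-suffixes : ∀ b p a d → eval (b ∷ p) (a + d) ≈ eval (b ∷ p) a + d * eval (suffixes p a) (a + d)
    eval-suffixes b []      a d = trans (+-congˡ (zeroʳ (a + d)))
      (sym (trans (+-cong (+-congˡ (zeroʳ a)) (zeroʳ d)) (+-identityʳ _)))
    eval-suffixes b (c ∷ p) a d = trans
      (+-congˡ (*-congˡ (eval-suffixes c p a d)))
      (solve 5 (λ b a d v q → b :+ (a :+ d) :* (v :+ d :* q) := (b :+ a :* v) :+ d :* (v :+ (a :+ d) :* q))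
        refl b a d (eval (c ∷ p) a) (eval (suffixes p a) (a + d)))

    -- Each quotient entry is a coefficient plus `a` times the value of the part above it, so the
    -- coefficients vanish from the top downwards.
    suffixes-zero : ∀ p a → (∀ i → coef (suffixes p a) i ≈ 0#) → ∀ i → coef p i ≈ 0#
    suffixes-zero (b ∷ p) a h (suc i) = suffixes-zero p a (h ∘ suc) i
    suffixes-zero (b ∷ p) a h zero    = begin
      b                ≈⟨ +-identityʳ b ⟨
      b + 0#           ≈⟨ +-congˡ (zeroʳ a) ⟨
      b + a * 0#       ≈⟨ +-congˡ (*-congˡ (eval-zero p a (suffixes-zero p a (h ∘ suc)))) ⟨
      b + a * eval p a ≈⟨ h 0 ⟩
      0#               ∎
    suffixes-zero []      a h i       = refl

  -- Enough for the comparison of polynomials, because the sample points are natural numbers and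
  -- only their differences have to be cancelled.
  TorsionFree : Set _
  TorsionFree = ∀ k x → (suc k · 1#) * x ≈ 0# → x ≈ 0#

  module _ (torsionFree : TorsionFree) where

    private

      -- Dividing out the root N leaves a shorter polynomial q with (k + 1) · q(N + 1 + k) = 0, so q
      -- vanishes from N + 1 on. This is why the starting point N varies; `d` carries the recursion,
      -- as the quotient is not a sublist.
      vanishing : ∀ d p N → length p ≡ d → (∀ k → eval p ((N ℕ.+ k) · 1#) ≈ 0#) → ∀ i → coef p i ≈ 0#
      vanishing d       []      N _     h i = refl
      vanishing (suc d) (b ∷ p) N ∣p∣≡d h   = λ
        { zero    → begin
            b                  ≈⟨ +-identityʳ b ⟨
            b + 0#             ≈⟨ +-congˡ (zeroʳ a) ⟨
            b + a * 0#         ≈⟨ +-congˡ (*-congˡ (eval-zero p a p≈0)) ⟨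
            eval (b ∷ p) a     ≈⟨ root ⟩
            0#                 ∎
        ; (suc i) → p≈0 i
        }
        where
        a : Carrier
        a = N · 1#
        root : eval (b ∷ p) a ≈ 0#
        root = trans (reflexive (≡.cong (λ m → eval (b ∷ p) (m · 1#)) (≡.sym (ℕ.+-identityʳ N)))) (h 0)
        next : ∀ k → eval (suffixes p a) ((suc N ℕ.+ k) · 1#) ≈ 0#
        next k = torsionFree k _ (begin
          e * eval (suffixes p a) ((suc N ℕ.+ k) · 1#)
            ≈⟨ *-congˡ (eval-congˡ (suffixes p a) sum≈) ⟩
          e * eval (suffixes p a) (a + e)
            ≈⟨ +-identityˡ _ ⟨
          0# + e * eval (suffixes p a) (a + e)
            ≈⟨ +-congʳ root ⟨
          eval (b ∷ p) a + e * eval (suffixes p a) (a + e)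
            ≈⟨ eval-suffixes b p a e ⟨
          eval (b ∷ p) (a + e)
            ≈⟨ eval-congˡ (b ∷ p) (×-homo-+ 1# N (suc k)) ⟨
          eval (b ∷ p) ((N ℕ.+ suc k) · 1#)
            ≈⟨ h (suc k) ⟩
          0# ∎)
          where
          e : Carrier
          e = suc k · 1#
          sum≈ : (suc N ℕ.+ k) · 1# ≈ a + e
          sum≈ = trans (reflexive (≡.cong (_· 1#) (≡.sym (ℕ.+-suc N k)))) (×-homo-+ 1# N (suc k))
        p≈0 : ∀ i → coef p i ≈ 0#
        p≈0 = suffixes-zero p a
          (vanishing d (suffixes p a) (suc N) (≡.trans (length-suffixes p a) (ℕ.suc-injective ∣p∣≡d)) next)

    coef-unique : ∀ p q → (∀ k → eval p (k · 1#) ≈ eval q (k · 1#)) → ∀ i → coef p i ≈ coef q i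
    coef-unique p q p≈q i = x∙y⁻¹≈ε⇒x≈y _ _ (begin
      coef p i - coef q i                  ≈⟨ +-congˡ (-1*x≈-x (coef q i)) ⟨
      coef p i + - 1# * coef q i           ≈⟨ +-congˡ (coef-scale i (- 1#) q) ⟨
      coef p i + coef (scale (- 1#) q) i   ≈⟨ coef-⊕ i p (scale (- 1#) q) ⟨
      coef (p ⊕ scale (- 1#) q) i          ≈⟨ vanishing _ (p ⊕ scale (- 1#) q) 0 ≡.refl difference i ⟩
      0#                                   ∎)
      where
      difference : ∀ k → eval (p ⊕ scale (- 1#) q) (k · 1#) ≈ 0#
      difference k = begin
        eval (p ⊕ scale (- 1#) q) x          ≈⟨ eval-⊕ x p (scale (- 1#) q) ⟩
        eval p x + eval (scale (- 1#) q) x   ≈⟨ +-congˡ (eval-scale x (- 1#) q) ⟩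
        eval p x + - 1# * eval q x           ≈⟨ +-cong (p≈q k) (-1*x≈-x (eval q x)) ⟩
        eval q x - eval q x                  ≈⟨ -‿inverseʳ (eval q x) ⟩
        0#                                   ∎
        where
        x : Carrier
        x = k · 1#

  -- The recursion of `_*ˢ_` with polynomials in l as right-hand coefficients. Only addition and
  -- scaling of polynomials occur, so every linear functional, a coefficient or an evaluation alike,
  -- turns it into `_*ˢ_`.
  _⋆_ : Series → (ℕ → Poly) → ℕ → Poly
  (f ⋆ p) zero    = scale (f 0) (p 0)
  (f ⋆ p) (suc n) = (∂ f ⋆ p) n ⊕ (f ⋆ (p ∘ suc)) n

  ⋆-linear : ∀ (φ : Poly → Carrier) → (∀ p q → φ (p ⊕ q) ≈ φ p + φ q) →
    (∀ a p → φ (scale a p) ≈ a * φ p) → ∀ n f p → φ ((f ⋆ p) n) ≈ (f *ˢ (φ ∘ p)) n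
  ⋆-linear φ φ-⊕ φ-scale zero    f p = φ-scale (f 0) (p 0)
  ⋆-linear φ φ-⊕ φ-scale (suc n) f p = trans (φ-⊕ _ _)
    (+-cong (⋆-linear φ φ-⊕ φ-scale n (∂ f) p) (⋆-linear φ φ-⊕ φ-scale n f (p ∘ suc)))

  -- If p n is a polynomial in l with values the coefficients of f^l, then its
  -- linear coefficients are those of log f; this is (log f)′ = f′ / f.
  linearCoefficients : TorsionFree → ∀ f (p : ℕ → Poly) →
    (∀ l n → eval (p n) (l · 1#) ≈ ∏ˢ {l} (λ _ → f) n) →
    f *ˢ ∂ (λ n → coef (p n) 1) ≋ ∂ f
  linearCoefficients torsionFree f p p≈ = mk≋ λ n → begin
    (f *ˢ (λ k → coef (p (suc k)) 1)) n
      ≈⟨ ⋆-linear (λ q → coef q 1) (coef-⊕ 1) (coef-scale 1) n f (p ∘ suc) ⟨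
    coef ((f ⋆ (p ∘ suc)) n) 1
      -- Prefixing `0#` multiplies by the variable l, so the linear coefficient on the right is the
      -- constant coefficient of the unprefixed polynomial.
      ≈⟨ coef-unique torsionFree ((f ⋆ (p ∘ suc)) n) (0# ∷ (∂ f ⋆ p) n) (agree n) 1 ⟩
    coef ((∂ f ⋆ p) n) 0
      ≈⟨ ⋆-linear (λ q → coef q 0) (coef-⊕ 0) (coef-scale 0) n (∂ f) p ⟩
    (∂ f *ˢ (λ k → coef (p k) 0)) n
      -- A constant coefficient is the value at l = 0, where the power is the empty product `1ˢ`.
      ≈⟨ at (H.*-congˡ {x = ∂ f} (mk≋ λ k → trans (coef-0 (p k)) (p≈ 0 k))) n ⟩
    (∂ f *ˢ 1ˢ) n
      ≈⟨ at (H.*-identityʳ (∂ f)) n ⟩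
    ∂ f n
      ∎
    where
    module H = CommutativeRing series-commutativeRing
    agree : ∀ n l → eval ((f ⋆ (p ∘ suc)) n) (l · 1#) ≈ eval (0# ∷ (∂ f ⋆ p) n) (l · 1#)
    agree n l = begin
      eval ((f ⋆ (p ∘ suc)) n) x
        ≈⟨ ⋆-linear (λ q → eval q x) (eval-⊕ x) (eval-scale x) n f (p ∘ suc) ⟩
      (f *ˢ (λ k → eval (p (suc k)) x)) n
        ≈⟨ at (H.*-congˡ {x = f} (mk≋ λ k → p≈ l (suc k))) n ⟩
      (f *ˢ ∂ P) n
        ≈⟨ at (∂-power f l) n ⟩
      (const x *ˢ (∂ f *ˢ P)) n
        ≈⟨ const-* x (∂ f *ˢ P) n ⟩
      x * (∂ f *ˢ P) n
        ≈⟨ *-congˡ (at (H.*-congˡ {x = ∂ f} (mk≋ λ k → p≈ l k)) n) ⟨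
      x * (∂ f *ˢ (λ k → eval (p k) x)) n
        ≈⟨ *-congˡ (⋆-linear (λ q → eval q x) (eval-⊕ x) (eval-scale x) n (∂ f) p) ⟨
      x * eval ((∂ f ⋆ p) n) x
        ≈⟨ +-identityˡ _ ⟨
      eval (0# ∷ (∂ f ⋆ p) n) x
        ∎
      where
      x : Carrier
      x = l · 1#
      P : Series
      P = ∏ˢ {l} (λ _ → f)

  ×-zero : ∀ n → n · 0# ≈ 0#
  ×-zero zero    = refl
  ×-zero (suc n) = trans (+-identityˡ _) (×-zero n)

  toSeries : Poly → Series
  toSeries p n = (n !) · coef p n

  -- The series 1 − s x and its inverse Σ sⁿ xⁿ.
  linear geometric : Carrier → Series
  linear s zero    = 1#
  linear s (suc n) = const (- s) n
  geometric s n    = (n !) · (s ^ n)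

  -- In exponential coefficients, multiplication by x sends f to n ↦ n · f(n - 1); this is where the
  -- multiple `suc n` comes from.
  linear-* : ∀ n s f → (linear s *ˢ f) (suc n) ≈ f (suc n) - suc n · (s * f n)
  linear-* zero    s f = begin
    - s * f 0 + 1# * f 1          ≈⟨ +-comm _ _ ⟩
    1# * f 1 + - s * f 0          ≈⟨ +-cong (*-identityˡ (f 1)) (sym (-‿distribˡ-* s (f 0))) ⟩
    f 1 - s * f 0                 ≈⟨ +-congˡ (-‿cong (+-identityʳ _)) ⟨
    f 1 - (s * f 0 + 0#)          ∎
  linear-* (suc n) s f = begin
    (const (- s) *ˢ f) (suc n) + (linear s *ˢ ∂ f) (suc n)
      ≈⟨ +-cong (trans (const-* (- s) f (suc n)) (sym (-‿distribˡ-* s (f (suc n))))) (linear-* n s (∂ f)) ⟩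
    - y + (f (suc (suc n)) - suc n · y)
      ≈⟨ +-comm _ _ ⟩
    (f (suc (suc n)) - suc n · y) - y
      ≈⟨ +-assoc _ _ _ ⟩
    f (suc (suc n)) + (- (suc n · y) - y)
      ≈⟨ +-congˡ (trans (+-comm _ _) (-‿+-comm y (suc n · y))) ⟩
    f (suc (suc n)) - (y + suc n · y)
      ∎
    where
    y : Carrier
    y = s * f (suc n)

  linear*geometric : ∀ s → linear s *ˢ geometric s ≋ 1ˢ
  linear*geometric s = mk≋ λ
    { zero    → trans (*-identityˡ _) (+-identityʳ 1#)
    ; (suc n) → begin
        (linear s *ˢ geometric s) (suc n)
          ≈⟨ linear-* n s (geometric s) ⟩
        (suc n !) · (s * s ^ n) - suc n · (s * (n !) · (s ^ n))
          ≈⟨ +-congˡ (-‿cong (trans (×-congʳ (suc n) (×-comm-* (n !) s (s ^ n)))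
               (×-assocˡ (s * s ^ n) (suc n) (n !)))) ⟩
        (suc n !) · (s * s ^ n) - (suc n !) · (s * s ^ n)
          ≈⟨ -‿inverseʳ _ ⟩
        0#
          ∎
    }

  -- A coefficient list stands between the pointwise factorisation of Eₘ, which `coef-unique` can
  -- compare with it, and the formal product of the series `linear (s i)`.
  linearProduct : ∀ {m} → (Fin m → Carrier) → Poly
  linearProduct {zero}  s = 1# ∷ []
  linearProduct {suc m} s = linearProduct (s ∘ suc) ⊕ (0# ∷ scale (- s zero) (linearProduct (s ∘ suc)))

  eval-linearProduct : ∀ {m} (s : Fin m → Carrier) x →
    eval (linearProduct s) x ≈ ∏.sum (λ i → 1# + x * - s i)
  eval-linearProduct {zero}  s x = trans (+-congˡ (zeroʳ x)) (+-identityʳ 1#)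
  eval-linearProduct {suc m} s x = begin
    eval (q ⊕ (0# ∷ scale (- s zero) q)) x        ≈⟨ eval-⊕ x q _ ⟩
    y + (0# + x * eval (scale (- s zero) q) x)    ≈⟨ +-congˡ (+-identityˡ _) ⟩
    y + x * eval (scale (- s zero) q) x           ≈⟨ +-congˡ (*-congˡ (eval-scale x (- s zero) q)) ⟩
    y + x * (- s zero * y)                        ≈⟨ +-cong (*-identityˡ y) (*-assoc x (- s zero) y) ⟨
    1# * y + x * - s zero * y                     ≈⟨ distribʳ y 1# (x * - s zero) ⟨
    (1# + x * - s zero) * y                       ≈⟨ *-congˡ (eval-linearProduct (s ∘ suc) x) ⟩
    ∏.sum (λ i → 1# + x * - s i)                  ∎
    where
    q : Poly
    q = linearProduct (s ∘ suc)
    y : Carrier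
    y = eval q x

  toSeries-linearProduct : ∀ {m} (s : Fin m → Carrier) →
    toSeries (linearProduct s) ≋ ∏ˢ (λ i → linear (s i))
  toSeries-linearProduct {zero}  s = mk≋ λ
    { zero    → +-identityʳ 1#
    ; (suc n) → ×-zero (suc n !)
    }
  toSeries-linearProduct {suc m} s = H.trans (mk≋ λ
    { zero    → begin
        coef (q ⊕ (0# ∷ q′)) 0 + 0#        ≈⟨ +-congʳ (coef-⊕ 0 q (0# ∷ q′)) ⟩
        (coef q 0 + 0#) + 0#               ≈⟨ +-congʳ (+-identityʳ _) ⟩
        coef q 0 + 0#                      ≈⟨ *-identityˡ _ ⟨
        1# * toSeries q 0                  ∎
    ; (suc n) → begin
        (suc n !) · coef (q ⊕ (0# ∷ q′)) (suc n)
          ≈⟨ ×-congʳ (suc n !) (coef-⊕ (suc n) q (0# ∷ q′)) ⟩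
        (suc n !) · (coef q (suc n) + coef q′ n)
          ≈⟨ ×-distrib-+ _ _ (suc n !) ⟩
        toSeries q (suc n) + (suc n !) · coef q′ n
          ≈⟨ +-congˡ (×-congʳ (suc n !) (coef-scale n (- s₀) q)) ⟩
        toSeries q (suc n) + (suc n !) · (- s₀ * coef q n)
          ≈⟨ +-congˡ (×-comm-* (suc n !) (- s₀) (coef q n)) ⟨
        toSeries q (suc n) + - s₀ * (suc n !) · coef q n
          ≈⟨ +-congˡ (-‿distribˡ-* s₀ _) ⟨
        toSeries q (suc n) - s₀ * (suc n !) · coef q n
          ≈⟨ +-congˡ (-‿cong (trans (*-congˡ (sym (×-assocˡ (coef q n) (suc n) (n !))))
               (×-comm-* (suc n) s₀ _))) ⟩
        toSeries q (suc n) - suc n · (s₀ * toSeries q n)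
          ≈⟨ linear-* n s₀ (toSeries q) ⟨
        (linear s₀ *ˢ toSeries q) (suc n)
          ∎
    })
    (H.*-congˡ {x = linear s₀} (toSeries-linearProduct (s ∘ suc)))
    where
    module H = CommutativeRing series-commutativeRing
    s₀ : Carrier
    s₀ = s zero
    q q′ : Poly
    q = linearProduct (s ∘ suc)
    q′ = scale (- s₀) q

-- Logarithmic derivative of the truncated exponential and power sums

module RootSums {c ℓ} (A : CommutativeRing c ℓ) where

  open CommutativeRing A hiding (zero)
  open Algebra.Properties.Ring ring
  open Hurwitz A
  open ListPolynomials A
  open SetoidReasoning setoid
  open Mult semiring renaming (_×_ to _·_)
  open Exp semiring using (_^_)
  open SemiringSum semiring using (sum; sum-cong-≋; *-distribˡ-sum)
  private
    module H = CommutativeRing series-commutativeRing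
    module HS = Solver H.commutativeSemiring
    module H≈ = SetoidReasoning H.setoid
    module ∏ = Sum *-commutativeMonoid
    module ∏ˢ = Sum H.*-commutativeMonoid

  indicator : ∀ {p} {P : Set p} → Dec P → Carrier
  indicator P? = if does P? then 1# else 0#

  -- Two roles meet here: these are the exponential coefficients of Eₘ for r = m + 1, and the n-th
  -- one tells whether a colour class of size n is admissible.
  truncatedExp : ℕ → Series
  truncatedExp r n = indicator (n ℕ.<? r)

  eval-tabulate : ∀ {m} (f : Fin m → Carrier) x →
    eval (tabulate f) x ≈ sum (λ k → f k * x ^ toℕ k)
  eval-tabulate {zero}  f x = refl
  eval-tabulate {suc m} f x = +-cong (sym (*-identityʳ (f zero))) (begin
    x * eval (tabulate (f ∘ suc)) x                     ≈⟨ *-congˡ (eval-tabulate (f ∘ suc) x) ⟩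
    x * sum (λ k → f (suc k) * x ^ toℕ k)               ≈⟨ *-distribˡ-sum {m} x _ ⟩
    sum (λ k → x * (f (suc k) * x ^ toℕ k))
      ≈⟨ sum-cong-≋ {m} (λ k → x*[a*y] (f (suc k)) (x ^ toℕ k)) ⟩
    sum (λ k → f (suc k) * (x * x ^ toℕ k))             ∎)
    where
    x*[a*y] : ∀ a y → x * (a * y) ≈ a * (x * y)
    x*[a*y] a y = trans (sym (*-assoc x a y)) (trans (*-congʳ (*-comm x a)) (*-assoc a x y))

  coef-tabulate : ∀ m e n →
    coef (tabulate {n = m} (e ∘ toℕ)) n ≡ (if does (n ℕ.<? m) then e n else 0#)
  coef-tabulate zero    e n       = ≡.refl
  coef-tabulate (suc m) e zero    = ≡.refl
  coef-tabulate (suc m) e (suc n) = coef-tabulate m (e ∘ suc) n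

  toSeries-tabulate : ∀ m {e} → (∀ n → (n !) · e n ≈ 1#) →
    toSeries (tabulate {n = m} (e ∘ toℕ)) ≋ truncatedExp m
  toSeries-tabulate m {e} n!e≈1 = mk≋ λ n →
    trans (×-congʳ (n !) (reflexive (coef-tabulate m e n))) (select n (does (n ℕ.<? m)))
    where
    select : ∀ n b → (n !) · (if b then e n else 0#) ≈ (if b then 1# else 0#)
    select n true  = n!e≈1 n
    select n false = ×-zero (n !)

  ∂-∏-linear : ∀ {m} (s : Fin m → Carrier) →
    ∂ (∏ˢ (λ i → linear (s i)))
      ≋ ∏ˢ (λ i → linear (s i)) *ˢ ∑ˢ (λ i → const (- s i) *ˢ geometric (s i))
  ∂-∏-linear {zero}  s = H.sym (H.zeroʳ 1ˢ)
  ∂-∏-linear {suc m} s = H≈.begin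
    k *ˢ P +ˢ L *ˢ ∂ P
      H≈.≈⟨ H.+-congˡ {x = k *ˢ P} (H.*-congˡ {x = L} (∂-∏-linear (s ∘ suc))) ⟩
    k *ˢ P +ˢ L *ˢ (P *ˢ S)
      -- Differentiation has replaced `L` by the constant `k`; inserting `L *ˢ G`, which is 1,
      -- restores the missing factor of the full product.
      H≈.≈⟨ H.+-congʳ {x = L *ˢ (P *ˢ S)} (H.*-congʳ {x = P}
              (H.trans (H.*-congˡ {x = k} (linear*geometric (s zero))) (H.*-identityʳ k))) ⟨
    k *ˢ (L *ˢ G) *ˢ P +ˢ L *ˢ (P *ˢ S)
      H≈.≈⟨ HS.solve 5 (λ k L G P S →
              k HS.:* (L HS.:* G) HS.:* P HS.:+ L HS.:* (P HS.:* S)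
                HS.:= L HS.:* P HS.:* (k HS.:* G HS.:+ S)) H.refl k L G P S ⟩
    L *ˢ P *ˢ (k *ˢ G +ˢ S)
      H≈.∎
    where
    k L G P S : Series
    k = const (- s zero)
    L = linear (s zero)
    G = geometric (s zero)
    P = ∏ˢ (λ i → linear (s (suc i)))
    S = ∑ˢ (λ i → const (- s (suc i)) *ˢ geometric (s (suc i)))

  -- The product of the geometric series is an explicit inverse, so cancellation is safe even in the
  -- presence of zero divisors.
  ∏-linear-cancelˡ : ∀ {m} (s : Fin m → Carrier) {f g} →
    ∏ˢ (λ i → linear (s i)) *ˢ f ≋ ∏ˢ (λ i → linear (s i)) *ˢ g → f ≋ g
  ∏-linear-cancelˡ {m} s {f} {g} Lf≋Lg = H≈.begin
    f                 H≈.≈⟨ G*[L*-] f ⟨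
    G *ˢ (L *ˢ f)     H≈.≈⟨ H.*-congˡ {x = G} Lf≋Lg ⟩
    G *ˢ (L *ˢ g)     H≈.≈⟨ G*[L*-] g ⟩
    g                 H≈.∎
    where
    L G : Series
    L = ∏ˢ (λ i → linear (s i))
    G = ∏ˢ (λ i → geometric (s i))
    L*G : L *ˢ G ≋ 1ˢ
    L*G = H.trans (H.sym (∏ˢ.∑-distrib-+ {m} (λ i → linear (s i)) (λ i → geometric (s i))))
      (H.trans (∏ˢ.sum-cong-≋ {m} (λ i → linear*geometric (s i))) (∏ˢ.sum-replicate-zero m))
    G*[L*-] : ∀ h → G *ˢ (L *ˢ h) ≋ h
    G*[L*-] h = H.trans (H.sym (H.*-assoc G L h))
      (H.trans (H.*-congʳ {x = h} (H.trans (H.*-comm G L) L*G)) (H.*-identityˡ h))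

  -- By hypothesis Σ e k xᵏ is the truncated exponential series, with inverse
  -- roots s i, and p n has the coefficients n! [xⁿ] of its l-th power as values.
  linearCoefficient-powerSum : TorsionFree → ∀ {m} (s : Fin m → Carrier) (e : ℕ → Carrier) →
    (∀ n → (n !) · e n ≈ 1#) →
    (∀ x → sum {suc m} (λ k → e (toℕ k) * x ^ toℕ k) ≈ ∏.sum (λ i → 1# + x * - s i)) →
    ∀ p → (∀ l n → eval (p n) (l · 1#) ≈ ∏ˢ {l} (λ _ → truncatedExp (suc m)) n) →
    ∀ n → coef (p (suc n)) 1 ≈ - ((n !) · sum (λ i → s i ^ suc n))
  linearCoefficient-powerSum torsionFree {m} s e n!e≈1 factors p p≈ n = begin
    coef (p (suc n)) 1
      -- Index n of the derivative is index n + 1 of the series itself: hence the factorial of n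
      -- beside the power n + 1.
      ≈⟨ at logarithmicDerivative n ⟩
    ∑ˢ (λ i → const (- s i) *ˢ geometric (s i)) n
      ≈⟨ ∑ˢ-at (λ i → const (- s i) *ˢ geometric (s i)) n ⟩
    sum (λ i → (const (- s i) *ˢ geometric (s i)) n)
      ≈⟨ sum-cong-≋ {m} (λ i → term (s i)) ⟩
    sum (λ i → - ((n !) · 1#) * s i ^ suc n)
      ≈⟨ *-distribˡ-sum {m} (- ((n !) · 1#)) (λ i → s i ^ suc n) ⟨
    - ((n !) · 1#) * sum (λ i → s i ^ suc n)
      ≈⟨ -‿distribˡ-* _ _ ⟨
    - (((n !) · 1#) * sum (λ i → s i ^ suc n))
      ≈⟨ -‿cong (trans (×-assoc-* (n !) 1# _) (×-congʳ (n !) (*-identityˡ _))) ⟩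
    - ((n !) · sum (λ i → s i ^ suc n))
      ∎
    where
    E L : Series
    E = truncatedExp (suc m)
    L = ∏ˢ (λ i → linear (s i))

    taylor : Poly
    taylor = tabulate {n = suc m} (e ∘ toℕ)

    E≋L : E ≋ L
    E≋L = H≈.begin
      E                          H≈.≈⟨ toSeries-tabulate (suc m) n!e≈1 ⟨
      -- The hypothesis `factors` equates functions; its instances at natural numbers already fix
      -- the coefficients.
      toSeries taylor            H≈.≈⟨ mk≋ (λ k → ×-congʳ (k !)
                                          (coef-unique torsionFree taylor (linearProduct s) agree k)) ⟩
      toSeries (linearProduct s) H≈.≈⟨ toSeries-linearProduct s ⟩
      L                          H≈.∎
      where
      agree : ∀ k → eval taylor (k · 1#) ≈ eval (linearProduct s) (k · 1#)
      agree k = trans (eval-tabulate {suc m} (e ∘ toℕ) (k · 1#))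
        (trans (factors (k · 1#)) (sym (eval-linearProduct s (k · 1#))))

    logarithmicDerivative : ∂ (λ k → coef (p k) 1) ≋ ∑ˢ (λ i → const (- s i) *ˢ geometric (s i))
    logarithmicDerivative = ∏-linear-cancelˡ s (H≈.begin
      L *ˢ ∂ (λ k → coef (p k) 1)   H≈.≈⟨ H.*-congʳ {x = ∂ (λ k → coef (p k) 1)} E≋L ⟨
      E *ˢ ∂ (λ k → coef (p k) 1)   H≈.≈⟨ linearCoefficients torsionFree E p p≈ ⟩
      ∂ E                           H≈.≈⟨ mk≋ (λ k → at E≋L (suc k)) ⟩
      ∂ L                           H≈.≈⟨ ∂-∏-linear s ⟩
      L *ˢ ∑ˢ (λ i → const (- s i) *ˢ geometric (s i)) H≈.∎)

    term : ∀ s → (const (- s) *ˢ geometric s) n ≈ - ((n !) · 1#) * s ^ suc n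
    term s = begin
      (const (- s) *ˢ geometric s) n     ≈⟨ const-* (- s) (geometric s) n ⟩
      - s * (n !) · (s ^ n)              ≈⟨ -‿distribˡ-* s _ ⟨
      - (s * (n !) · (s ^ n))            ≈⟨ -‿cong (×-comm-* (n !) s (s ^ n)) ⟩
      - ((n !) · (s ^ suc n))
        ≈⟨ -‿cong (trans (×-assoc-* (n !) 1# _) (×-congʳ (n !) (*-identityˡ _))) ⟨
      - ((n !) · 1# * s ^ suc n)         ≈⟨ -‿distribˡ-* _ _ ⟩
      - ((n !) · 1#) * s ^ suc n         ∎

-- Proper colourings of the complete hypergraph are those with small colour classes

-- Supplies an edge of `K` inside any colour class with at least r vertices.
subset-of-size : ∀ {n} (p : Subset n) k → k ≤ size p → ∃[ e ] e ⊆ p × size e ≡ k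
subset-of-size {n} p       zero    _       = ⊥ , Subset.⊥⊆ , Subset.∣⊥∣≡0 n
subset-of-size (true Vec.∷ p)  (suc k) (s≤s k≤) = let e , e⊆p , ∣e∣≡k = subset-of-size p k k≤ in
  true Vec.∷ e , Subset.s⊆s e⊆p , ≡.cong suc ∣e∣≡k
subset-of-size (false Vec.∷ p) (suc k) k≤      = let e , e⊆p , ∣e∣≡k = subset-of-size p (suc k) k≤ in
  false Vec.∷ e , Subset.s⊆s e⊆p , ∣e∣≡k

module _ {n l} (π : Fin n → Fin l) where

  ∈colourClass⁺ : ∀ {x c} → π x ≡ c → x ∈ colourClass π c
  ∈colourClass⁺ {x} {c} πx≡c = Vec.lookup⇒[]= x (colourClass π c)
    (≡.trans (Vec.lookup∘tabulate _ x) (dec-true (π x Fin.≟ c) πx≡c))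

  ∈colourClass⁻ : ∀ {x c} → x ∈ colourClass π c → π x ≡ c
  ∈colourClass⁻ {x} {c} x∈ with π x Fin.≟ c | ≡.trans
    (≡.sym (Vec.lookup∘tabulate (λ x → does (π x Fin.≟ c)) x)) (Vec.[]=⇒lookup x∈)
  ... | yes πx≡c | _ = πx≡c

  module _ {r} (2≤r : 2 ≤ r) (1≤n : 1 ≤ n) where

    proper⇒smallClasses : Proper (K r n 2≤r 1≤n) π → ∀ c → size (colourClass π c) < r
    proper⇒smallClasses proper c = ℕ.≰⇒> λ r≤ →
      let e , e⊆ , ∣e∣≡r = subset-of-size (colourClass π c) r r≤
          x , y , x∈e , y∈e , πx≢πy = proper e ∣e∣≡r
      in πx≢πy (≡.trans (∈colourClass⁻ (e⊆ x∈e)) (≡.sym (∈colourClass⁻ (e⊆ y∈e))))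

    -- A monochromatic edge lies in the class of any one of its vertices, which then has at least r
    -- elements. The search for two differently coloured vertices is finite, so arguing by
    -- contradiction is legitimate.
    smallClasses⇒proper : (∀ c → size (colourClass π c) < r) → Proper (K r n 2≤r 1≤n) π
    smallClasses⇒proper small e ∣e∣≡r = decidable-stable
      (Fin.any? λ x → Fin.any? λ y → (x Subset.∈? e) ×-dec (y Subset.∈? e) ×-dec ¬? (π x Fin.≟ π y))
      λ monochromatic → nonempty λ (y , y∈e) →
        ℕ.<⇒≱ (small (π y)) (≡.subst (_≤ size (colourClass π (π y))) ∣e∣≡r
          (Subset.p⊆q⇒∣p∣≤∣q∣ λ {x} x∈e → ∈colourClass⁺ (decidable-stable (π x Fin.≟ π y)
            λ πx≢πy → monochromatic (x , y , x∈e , y∈e , πx≢πy))))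
      where
      -- The double negation suffices because its use ends in a contradiction; an empty edge would
      -- force r = 0.
      nonempty : ¬ ¬ Nonempty e
      nonempty empty = ℕ.<⇒≱ 2≤r (≡.subst (_≤ 1) 0≡r z≤n)
        where
        0≡r : 0 ≡ r
        0≡r = ≡.trans (≡.sym (≡.trans (≡.cong size (Subset.Empty-unique empty)) (Subset.∣⊥∣≡0 n))) ∣e∣≡r

-- Counting proper colourings by powers of the truncated exponential

module Counting {c ℓ} (A : CommutativeRing c ℓ) where

  open CommutativeRing A hiding (zero)
  open Hurwitz A
  open ExponentialFormula A
  open RootSums A using (indicator; truncatedExp)
  open SetoidReasoning setoid
  open Mult semiring using () renaming (_×_ to _·_)
  open SemiringSum semiring using (sum; sum-cong-≋)
  private
    module ∏ = Sum *-commutativeMonoid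

  length-filter : ∀ {B : Set} {P : Pred B 0ℓ} (P? : Decidable P) {m} (f : Fin m → B) →
    length (filter P? (tabulate f)) · 1# ≈ sum (λ i → indicator (P? (f i)))
  length-filter P? {zero}  f = refl
  length-filter P? {suc m} f with P? (f zero)
  ... | yes _ = +-congˡ (length-filter P? (f ∘ suc))
  ... | no  _ = trans (length-filter P? (f ∘ suc)) (sym (+-identityˡ _))

  -- When `Q` fails, finite search finds a colour where `P` fails, and that single factor
  -- annihilates the product.
  ∏-indicator : ∀ {l} {P : Fin l → Set} {Q : Set} (P? : Decidable P) (Q? : Dec Q) →
    (Q → ∀ c → P c) → ((∀ c → P c) → Q) → ∏.sum (λ c → indicator (P? c)) ≈ indicator Q?
  ∏-indicator {l} {P} P? (yes q) Q⇒P P⇒Q =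
    trans (∏.sum-cong-≋ {l} (λ c → holds (P? c) (Q⇒P q c))) (∏.sum-replicate-zero l)
    where
    holds : ∀ {c} (Pc? : Dec (P c)) → P c → indicator Pc? ≈ 1#
    holds (yes _) _  = refl
    holds (no ¬p) p = contradiction p ¬p
  ∏-indicator {zero} P? (no ¬q) Q⇒P P⇒Q = contradiction (P⇒Q λ ()) ¬q
  ∏-indicator {suc l} {P} P? (no ¬q) Q⇒P P⇒Q =
    let c , ¬Pc = Fin.¬∀⟶∃¬ (suc l) P P? (¬q ∘ P⇒Q)
    in trans (∏.sum-remove {i = c} (λ c → indicator (P? c))) (trans (*-congʳ (fails (P? c) ¬Pc)) (zeroˡ _))
    where
    fails : ∀ {c} (Pc? : Dec (P c)) → ¬ P c → indicator Pc? ≈ 0#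
    fails (yes p) ¬p = contradiction p ¬p
    fails (no _)  _  = refl

  #properColourings-K : ∀ r n (2≤r : 2 ≤ r) (1≤n : 1 ≤ n) l →
    #properColourings (K r n 2≤r 1≤n) l · 1# ≈ ∏ˢ {l} (λ _ → truncatedExp r) n
  #properColourings-K r n 2≤r 1≤n l = begin
    #properColourings H l · 1#
      ≈⟨ length-filter (λ i → proper? H Fin._≟_ (finToFun {l} {n} i)) {l ℕ.^ n} (λ i → i) ⟩
    sum {l ℕ.^ n} (λ i → indicator (proper? H Fin._≟_ (finToFun {l} {n} i)))
      ≈⟨ sum-cong-≋ {l ℕ.^ n} (λ i → properWeight (finToFun {l} {n} i)) ⟨
    sum {l ℕ.^ n} (λ i → weight (λ _ → truncatedExp r) (finToFun {l} {n} i))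
      ≈⟨ exponential-formula n (λ _ → truncatedExp r) ⟩
    ∏ˢ {l} (λ _ → truncatedExp r) n
      ∎
    where
    H = K r n 2≤r 1≤n
    properWeight : (π : Fin n → Fin l) →
      weight (λ _ → truncatedExp r) π ≈ indicator (proper? H Fin._≟_ π)
    properWeight π = ∏-indicator (λ c → size (colourClass π c) ℕ.<? r) (proper? H Fin._≟_ π)
      (proper⇒smallClasses π 2≤r 1≤n) (smallClasses⇒proper π 2≤r 1≤n)

-- Specialisation to the complex numbers

open ComplexNumbers using (ℂ; ℂ-commutativeRing; fromℚ; mk≈)
open CauchyReals using (pointwise)
open ChromaticPolynomial using (a₁; chromaticPolynomial; chromaticPolynomial-counts)
open TaylorRoots using (AreRootsOfE; μ; fromℤ; E; 1/_!; root-invertible; rootInverse)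
open CommutativeRing ℂ-commutativeRing hiding (zero)
open Algebra.Properties.Ring ring
open SetoidReasoning setoid
open Mult semiring using (×-congʳ; ×-assoc-*) renaming (_×_ to _·_)
open Exp semiring using (_^_)
open Hurwitz ℂ-commutativeRing using (∏ˢ; ∏ˢ-at-0)
open ListPolynomials ℂ-commutativeRing using (Poly; coef; coef-0; eval; eval-congˡ; TorsionFree)
open RootSums ℂ-commutativeRing
open Counting ℂ-commutativeRing using (#properColourings-K)
private
  module ∏ = Sum *-commutativeMonoid

-- Arithmetic with `ℚ./` is checked on unnormalised fractions, where no reduction by a gcd obscures
-- the numerators.
toℚᵘ-/1 : ∀ i → toℚᵘ (i ℚ./ 1) ℚᵘ.≃ mkℚᵘ i 0
toℚᵘ-/1 i = ℚ.toℚᵘ-fromℚᵘ (mkℚᵘ i 0)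

/1-homo-+ : ∀ i j → (i ℤ.+ j) ℚ./ 1 ≡ (i ℚ./ 1) ℚ.+ (j ℚ./ 1)
/1-homo-+ i j = ℚ.toℚᵘ-injective (ℚᵘ.≃-trans (toℚᵘ-/1 (i ℤ.+ j)) (ℚᵘ.≃-sym
  (ℚᵘ.≃-trans (ℚ.toℚᵘ-homo-+ (i ℚ./ 1) (j ℚ./ 1))
    (ℚᵘ.≃-trans (ℚᵘ.+-cong (toℚᵘ-/1 i) (toℚᵘ-/1 j))
      (*≡* (≡.cong (ℤ._* 1ℤ) (≡.cong₂ ℤ._+_ (ℤ.*-identityʳ i) (ℤ.*-identityʳ j))))))))

/1-homo-* : ∀ i j → (i ℤ.* j) ℚ./ 1 ≡ (i ℚ./ 1) ℚ.* (j ℚ./ 1)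
/1-homo-* i j = ℚ.toℚᵘ-injective (ℚᵘ.≃-trans (toℚᵘ-/1 (i ℤ.* j)) (ℚᵘ.≃-sym
  (ℚᵘ.≃-trans (ℚ.toℚᵘ-homo-* (i ℚ./ 1) (j ℚ./ 1)) (ℚᵘ.*-cong (toℚᵘ-/1 i) (toℚᵘ-/1 j)))))

n*1/n : ∀ n .{{_ : ℕ.NonZero n}} → (+ n ℚ./ 1) ℚ.* (+ 1 ℚ./ n) ≡ 1ℚ
n*1/n n@(suc k) = ℚ.toℚᵘ-injective (ℚᵘ.≃-trans (ℚ.toℚᵘ-homo-* (+ n ℚ./ 1) (+ 1 ℚ./ n))
  (ℚᵘ.≃-trans (ℚᵘ.*-cong (toℚᵘ-/1 (+ n)) (ℚ.toℚᵘ-fromℚᵘ (mkℚᵘ (+ 1) k)))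
    (*≡* (≡.trans (ℤ.*-identityʳ _) (≡.trans (ℤ.*-comm (+ n) (+ 1)) (≡.sym
      (≡.trans (ℤ.*-identityˡ _) (≡.cong +_ (≡.trans (ℕ.*-identityˡ n) (≡.sym (ℕ.*-identityˡ n)))))))))))

fromℚ-cong : ∀ {p q} → p ≡ q → fromℚ p ≈ fromℚ q
fromℚ-cong ≡.refl = refl

fromℚ-homo-+ : ∀ p q → fromℚ (p ℚ.+ q) ≈ fromℚ p + fromℚ q
fromℚ-homo-+ p q = mk≈ (pointwise λ _ → ≡.refl) (pointwise λ _ → ≡.refl)

fromℚ-homo-* : ∀ p q → fromℚ (p ℚ.* q) ≈ fromℚ p * fromℚ q
fromℚ-homo-* p q = mk≈
  (pointwise λ _ → ≡.sym (ℚ.+-identityʳ (p ℚ.* q)))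
  (pointwise λ _ → ≡.sym (≡.cong₂ ℚ._+_ (ℚ.*-zeroʳ p) (ℚ.*-zeroˡ q)))

fromℤ-homo-+ : ∀ i j → fromℤ (i ℤ.+ j) ≈ fromℤ i + fromℤ j
fromℤ-homo-+ i j = trans (fromℚ-cong (/1-homo-+ i j)) (fromℚ-homo-+ (i ℚ./ 1) (j ℚ./ 1))

fromℤ-homo-* : ∀ i j → fromℤ (i ℤ.* j) ≈ fromℤ i * fromℤ j
fromℤ-homo-* i j = trans (fromℚ-cong (/1-homo-* i j)) (fromℚ-homo-* (i ℚ./ 1) (j ℚ./ 1))

·1≈fromℤ : ∀ n → n · 1# ≈ fromℤ (+ n)
·1≈fromℤ zero    = refl
·1≈fromℤ (suc n) = trans (+-congˡ (·1≈fromℤ n)) (sym (fromℤ-homo-+ (+ 1) (+ n)))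

·≈fromℤ* : ∀ n x → n · x ≈ fromℤ (+ n) * x
·≈fromℤ* n x = begin
  n · x               ≈⟨ ×-congʳ n (*-identityˡ x) ⟨
  n · (1# * x)        ≈⟨ ×-assoc-* n 1# x ⟨
  (n · 1#) * x        ≈⟨ *-congʳ (·1≈fromℤ n) ⟩
  fromℤ (+ n) * x     ∎

·-inverse : ∀ n .{{_ : ℕ.NonZero n}} → n · fromℚ (+ 1 ℚ./ n) ≈ 1#
·-inverse n = begin
  n · fromℚ (+ 1 ℚ./ n)                  ≈⟨ ·≈fromℤ* n _ ⟩
  fromℤ (+ n) * fromℚ (+ 1 ℚ./ n)        ≈⟨ fromℚ-homo-* (+ n ℚ./ 1) (+ 1 ℚ./ n) ⟨
  fromℚ ((+ n ℚ./ 1) ℚ.* (+ 1 ℚ./ n))    ≈⟨ fromℚ-cong (n*1/n n) ⟩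
  1#                                     ∎

-- Multiplication by the rational 1/n cancels n; inverting a general complex number would
-- constructively require a witness that it is apart from 0.
torsionFree : TorsionFree
torsionFree k x nx≈0 = begin
  x                           ≈⟨ *-identityˡ x ⟨
  1# * x                      ≈⟨ *-congʳ (·-inverse n) ⟨
  (n · q) * x                 ≈⟨ *-congʳ (trans (·≈fromℤ* n q)
                                   (trans (*-congʳ (sym (·1≈fromℤ n))) (*-comm _ q))) ⟩
  (q * (n · 1#)) * x          ≈⟨ *-assoc q (n · 1#) x ⟩
  q * ((n · 1#) * x)          ≈⟨ *-congˡ nx≈0 ⟩
  q * 0#                      ≈⟨ zeroʳ q ⟩
  0#                          ∎
  where
  n : ℕ
  n = suc k
  q : ℂ
  q = fromℚ (+ 1 ℚ./ n)

coef-map-fromℤ : ∀ p i → coef (map fromℤ p) i ≈ fromℤ (Polynomials.coefficient p i)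
coef-map-fromℤ []      i       = refl
coef-map-fromℤ (a ∷ p) zero    = refl
coef-map-fromℤ (a ∷ p) (suc i) = coef-map-fromℤ p i

eval-map-fromℤ : ∀ p x → eval (map fromℤ p) (fromℤ x) ≈ fromℤ (Polynomials.eval p x)
eval-map-fromℤ []      x = refl
eval-map-fromℤ (a ∷ p) x = begin
  fromℤ a + fromℤ x * eval (map fromℤ p) (fromℤ x)       ≈⟨ +-congˡ (*-congˡ (eval-map-fromℤ p x)) ⟩
  fromℤ a + fromℤ x * fromℤ (Polynomials.eval p x)       ≈⟨ +-congˡ (fromℤ-homo-* x _) ⟨
  fromℤ a + fromℤ (x ℤ.* Polynomials.eval p x)           ≈⟨ fromℤ-homo-+ a _ ⟨
  fromℤ (a ℤ.+ x ℤ.* Polynomials.eval p x)               ∎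

module _ {m} (R : Fin m → ℂ) (roots : AreRootsOfE m R) where

  private
    s : Fin m → ℂ
    s = rootInverse roots

    R*s : ∀ i → R i * s i ≈ 1#
    R*s i = proj₂ (proj₂ (root-invertible m R roots i))

    E-0 : E m 0# ≈ 1#
    E-0 = begin
      E m 0#
        ≈⟨ eval-tabulate {suc m} (λ k → fromℚ (1/ toℕ k !)) 0# ⟨
      eval (tabulate {n = suc m} (λ k → fromℚ (1/ toℕ k !))) 0#
        ≈⟨ coef-0 (tabulate {n = suc m} (λ k → fromℚ (1/ toℕ k !))) ⟨
      1#
        ∎

    -- Keeping `0# - R i` unsimplified makes the product of these factors literally the one in
    -- `splits` at 0.
    linearFactor : ∀ x i → x - R i ≈ (0# - R i) * (1# + x * - s i)
    linearFactor x i = sym (begin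
      (0# - R i) * (1# + x * - s i)           ≈⟨ *-cong (+-identityˡ (- R i))
                                                   (+-congˡ (sym (-‿distribʳ-* x (s i)))) ⟩
      - R i * (1# - x * s i)                  ≈⟨ distribˡ (- R i) 1# (- (x * s i)) ⟩
      - R i * 1# + - R i * - (x * s i)        ≈⟨ +-comm _ _ ⟩
      - R i * - (x * s i) + - R i * 1#        ≈⟨ +-cong (-x*-y≈x*y (R i) (x * s i)) (*-identityʳ (- R i)) ⟩
      R i * (x * s i) - R i                   ≈⟨ +-congʳ (trans (*-congˡ (*-comm x (s i)))
                                                   (sym (*-assoc (R i) (s i) x))) ⟩
      R i * s i * x - R i                     ≈⟨ +-congʳ (trans (*-congʳ (R*s i)) (*-identityˡ x)) ⟩
      x - R i                                 ∎)
      where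
      -x*-y≈x*y : ∀ x y → - x * - y ≈ x * y
      -x*-y≈x*y x y = trans (sym (-‿distribˡ-* x (- y)))
        (trans (-‿cong (sym (-‿distribʳ-* x y))) (-‿involutive (x * y)))

  -- After -Rᵢ is taken out of every factor, the constant left in front is (1/m!) · Πᵢ (0 - Rᵢ), the
  -- value of Eₘ at 0, which is 1.
  E-factors : ∀ x → E m x ≈ ∏.sum (λ i → 1# + x * - s i)
  E-factors x = begin
    E m x
      ≈⟨ AreRootsOfE.splits roots x ⟩
    c * ∏.sum (λ i → x - R i)
      ≈⟨ *-congˡ (trans (∏.sum-cong-≋ {m} (linearFactor x))
           (∏.∑-distrib-+ {m} (λ i → 0# - R i) (λ i → 1# + x * - s i))) ⟩
    c * (∏.sum (λ i → 0# - R i) * ∏.sum (λ i → 1# + x * - s i))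
      ≈⟨ *-assoc c _ _ ⟨
    c * ∏.sum (λ i → 0# - R i) * ∏.sum (λ i → 1# + x * - s i)
      ≈⟨ *-congʳ (trans (sym (AreRootsOfE.splits roots 0#)) E-0) ⟩
    1# * ∏.sum (λ i → 1# + x * - s i)
      ≈⟨ *-identityˡ _ ⟩
    ∏.sum (λ i → 1# + x * - s i)
      ∎
    where
    c : ℂ
    c = fromℚ (1/ m !)

-- K requires a vertex; the value 1 at n = 0 makes these the exponential
-- coefficients of the l-th power of the truncated exponential series.
chromaticPolynomials : ∀ r → 2 ℕ.≤ r → ℕ → Poly
chromaticPolynomials r 2≤r zero    = 1# ∷ []
chromaticPolynomials r 2≤r (suc n) = map fromℤ (chromaticPolynomial (K r (suc n) 2≤r (s≤s z≤n)))

eval-chromaticPolynomials : ∀ r 2≤r l n →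
  eval (chromaticPolynomials r 2≤r n) (l · 1#) ≈ ∏ˢ {l} (λ _ → truncatedExp r) n
-- Exposing r as a successor lets `truncatedExp r 0` reduce to `1#`, so every power has constant
-- term 1.
eval-chromaticPolynomials r@(suc _) 2≤r l zero = begin
  1# + (l · 1#) * 0#                       ≈⟨ trans (+-congˡ (zeroʳ _)) (+-identityʳ 1#) ⟩
  1#                                       ≈⟨ ∏.sum-replicate-zero l ⟨
  ∏.sum {l} (λ _ → 1#)                     ≈⟨ ∏ˢ-at-0 {l} (λ _ → truncatedExp r) ⟨
  ∏ˢ {l} (λ _ → truncatedExp r) 0          ∎
eval-chromaticPolynomials r 2≤r l (suc n) = begin
  eval (map fromℤ p) (l · 1#)              ≈⟨ eval-congˡ (map fromℤ p) (·1≈fromℤ l) ⟩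
  eval (map fromℤ p) (fromℤ (+ l))         ≈⟨ eval-map-fromℤ p (+ l) ⟩
  fromℤ (Polynomials.eval p (+ l))         ≡⟨ ≡.cong fromℤ (chromaticPolynomial-counts H l) ⟩
  fromℤ (+ #properColourings H l)          ≈⟨ ·1≈fromℤ (#properColourings H l) ⟨
  #properColourings H l · 1#               ≈⟨ #properColourings-K r (suc n) 2≤r (s≤s z≤n) l ⟩
  ∏ˢ {l} (λ _ → truncatedExp r) (suc n)    ∎
  where
  H : Hypergraphs.Hypergraph
  H = K r (suc n) 2≤r (s≤s z≤n)
  p : Polynomials.Polynomial
  p = chromaticPolynomial H

theorem4p1 : ∀ (r n : ℕ) (2≤r : 2 ≤ r) (1≤n : 1 ≤ n) →
    (R : Fin (r ∸ 1) → ℂ) (roots : AreRootsOfE (r ∸ 1) R) →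
    fromℤ (a₁ (K r n 2≤r 1≤n)) ≈ - (fromℤ (+ ((n ∸ 1) !)) * μ roots n)
-- Matching the proof of 1 ≤ n with `s≤s z≤n` makes the hypergraph coincide with the one chosen in
-- `chromaticPolynomials`.
theorem4p1 r@(suc m) (suc n) 2≤r (s≤s z≤n) R roots = begin
  fromℤ (a₁ (K r (suc n) 2≤r (s≤s z≤n)))
    ≈⟨ coef-map-fromℤ (chromaticPolynomial (K r (suc n) 2≤r (s≤s z≤n))) 1 ⟨
  coef (chromaticPolynomials r 2≤r (suc n)) 1
    ≈⟨ linearCoefficient-powerSum torsionFree (rootInverse roots) (λ k → fromℚ (1/ k !))
         (λ k → ·-inverse (k !) {{ℕ._!≢0 k}}) (E-factors R roots)
         (chromaticPolynomials r 2≤r) (eval-chromaticPolynomials r 2≤r) n ⟩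
  - ((n !) · μ roots (suc n))
    ≈⟨ -‿cong (·≈fromℤ* (n !) (μ roots (suc n))) ⟩
  - (fromℤ (+ (n !)) * μ roots (suc n))
    ∎
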